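{- Let $\mathcal{C}$ be a finite abstract simplicial complex and $\mathcal{M}$ a matroid on the same finite ground set $V$, and let $d\ge 0$ be an integer. If $\mathcal{C}$ is $d$-Leray and $r(\mathcal{M}[V\setminus A])\ge d+2$ for all $A\in\mathcal{C}$, then $\mathbf{RG}(\mathcal{C}^\star,\mathcal{M}^*)$ is connected.
   Context: $\mathcal{C}[X]=\{\sigma\in\mathcal{C}:\sigma\subseteq X\}$, $\mathcal{M}[X]=\{A\in\mathcal{M}:A\subseteq X\}$, $r$ is matroid rank. $\mathcal{C}$ is $d$-Leray if $\widetilde H_i(\mathcal{C}[X];\mathbb{Q})=0$ for all $X\subseteq V$ and all $i\ge d$. The Alexander dual is $\mathcal{C}^\star=\{X\subseteq V: V\setminus X\notin\mathcal{C}\}$. The dual matroid is $\mathcal{M}^*=\{A\subseteq V: r(\mathcal{M}[V\setminus A])=r(\mathcal{M})\}$. For a complex $\mathcal{D}$ and matroid $\mathcal{N}$ on $V$, $\mathbf{RG}(\mathcal{D},\mathcal{N})$ is the graph whose vertices are the bases of $\mathcal{N}$ that are simplices of $\mathcal{D}$, two being adjacent if their union is a simplex of $\mathcal{D}$ of cardinality $r(\mathcal{N})+1$. -}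

module Defs where

open import Data.Bool.Base using (if_then_else_)
open import Data.Empty using (⊥-elim)
open import Data.Fin.Base using (Fin; zero; suc)
open import Data.Fin.Properties using (any?)
open import Data.Fin.Subset using (Subset; inside; outside; ⊥; ⁅_⁆; _∈_; _∉_; _⊆_; ∁; _∩_; _∪_; ∣_∣)
open import Data.Fin.Subset.Properties using (_∈?_; _⊆?_; ∉⊥; ⊥⊆; ⊆-trans; p⊆q⇒∣p∣≤∣q∣; p⊂q⇒∣p∣<∣q∣; p⊆q⇒∁p⊇∁q; x∈∁p⇒x∉p; x∉p⇒x∈∁p; x∈p∩q⁺; p∩q⊆p; p∩q⊆q; p⊆p∪q; q⊆p∪q; x∈p∪q⁻; x∈⁅x⁆; x∈⁅y⁆⇒x≡y; ∪-comm; ∪-idem)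
open import Data.List.Base using (List; []; _∷_; map; _++_; filter)
open import Data.List.Extrema.Nat using (argmax; argmax-all; f[xs]≤f[argmax])
import Data.List.Membership.Propositional as List
open import Data.List.Membership.Propositional.Properties using (∈-++⁺ˡ; ∈-++⁺ʳ; ∈-map⁺; ∈-filter⁺)
import Data.List.Relation.Unary.All as All
open import Data.List.Relation.Unary.All.Properties using (all-filter)
open import Data.List.Relation.Unary.Any using (here)
open import Data.Nat.Base using (ℕ; zero; suc; _+_; _≤_; _<_; s≤s; z≤n)
open import Data.Nat.Properties using (_≟_; _<?_; ≤-trans; ≤-reflexive; ≤-antisym; <-irrefl; <-≤-trans; ≮⇒≥; n≤1+n; +-suc; +-comm; +-monoˡ-≤; +-monoʳ-<; m≤n+m; n≮n)
open import Data.Product.Base using (∃; _×_; _,_; proj₁; proj₂)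
open import Data.Rational.Base as ℚ using (ℚ; 0ℚ; 1ℚ)
open import Data.Rational.Properties using (+-0-commutativeMonoid)
open import Data.Sum.Base using ([_,_])
open import Data.Vec.Base using ([]; _∷_; here; there)
open import Level using (0ℓ)
open import Relation.Binary.Construct.Closure.ReflexiveTransitive using (Star)
open import Relation.Binary.Core using (Rel)
open import Relation.Binary.Definitions using (Symmetric)
open import Relation.Binary.PropositionalEquality using (_≡_; _≢_; refl; sym; trans; cong; subst)
open import Relation.Nullary using (¬_; yes; no; does)
open import Relation.Nullary.Decidable using (_×-dec_; ¬?)
open import Relation.Unary using (Pred; Decidable)

open import Algebra.Properties.CommutativeMonoid.Sum +-0-commutativeMonoid using (sum)

private
  variable
    n : ℕ

------------------------------------------------------------------------
-- Simplicial complexes on the ground set V = Fin n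

-- The void complex, with no faces at all, is allowed: it is the
-- Alexander dual of the full simplex.  Elements of V need not be
-- vertices of the complex.

record Complex (n : ℕ) : Set₁ where
  field
    Face        : Pred (Subset n) 0ℓ
    face?       : Decidable Face
    down-closed : ∀ {σ τ} → σ ⊆ τ → Face τ → Face σ

open Complex public

_[_] : Complex n → Subset n → Complex n
C [ X ] = record
  { Face        = λ σ → Face C σ × σ ⊆ X
  ; face?       = λ σ → face? C σ ×-dec (σ ⊆? X)
  ; down-closed = λ σ⊆τ (τ∈C , τ⊆X) → down-closed C σ⊆τ τ∈C , ⊆-trans σ⊆τ τ⊆X
  }

alexanderDual : Complex n → Complex n
alexanderDual C = record
  { Face        = λ X → ¬ Face C (∁ X)
  ; face?       = λ X → ¬? (face? C (∁ X))
  ; down-closed = λ σ⊆τ ∁τ∉C ∁σ∈C → ∁τ∉C (down-closed C (p⊆q⇒∁p⊇∁q σ⊆τ) ∁σ∈C)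
  }

------------------------------------------------------------------------
-- Reduced rational simplicial homology

-- c is an i-chain of C when it is a ℚ-combination of faces with i + 1
-- elements, each oriented by the order of Fin n.

IsChain : Complex n → ℕ → (Subset n → ℚ) → Set
IsChain C i c = ∀ σ → c σ ≢ 0ℚ → Face C σ × ∣ σ ∣ ≡ suc i

#below : Fin n → Subset n → ℕ
#below zero    τ             = 0
#below (suc v) (inside  ∷ τ) = suc (#below v τ)
#below (suc v) (outside ∷ τ) = #below v τ

[-1]^_ : ℕ → ℚ
[-1]^ zero  = 1ℚ
[-1]^ suc k = ℚ.- ([-1]^ k)

-- ∂ [v₀ < … < vᵢ] = Σⱼ (-1)ʲ [v₀ … v̂ⱼ … vᵢ], read off at the coefficient
-- of τ: the faces contributing to it are the τ ∪ {v} with v ∉ τ, and v is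
-- at position j = #below v τ of τ ∪ {v}.  On 0-chains the value at the
-- empty set is the augmentation, so the homology is reduced.

∂ : (Subset n → ℚ) → (Subset n → ℚ)
∂ c τ = sum λ v →
  if does (v ∈? τ) then 0ℚ else ([-1]^ (#below v τ)) ℚ.* c (τ ∪ ⁅ v ⁆)

IsCycle : Complex n → ℕ → (Subset n → ℚ) → Set
IsCycle C i z = IsChain C i z × (∀ τ → ∂ z τ ≡ 0ℚ)

IsBoundary : Complex n → ℕ → (Subset n → ℚ) → Set
IsBoundary C i z = ∃ λ w → IsChain C (suc i) w × (∀ σ → ∂ w σ ≡ z σ)

-- H̃ᵢ(C; ℚ) = 0, for i ≥ 0.

H̃-vanishes : ℕ → Complex n → Set
H̃-vanishes i C = ∀ z → IsCycle C i z → IsBoundary C i z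

Leray : ℕ → Complex n → Set
Leray d C = ∀ X i → d ≤ i → H̃-vanishes i (C [ X ])

------------------------------------------------------------------------
-- Matroids

record Matroid (n : ℕ) : Set₁ where
  field
    independents : Complex n

  Indep : Pred (Subset n) 0ℓ
  Indep = Face independents

  field
    ⊥-indep : Indep ⊥
    augment : ∀ {A B} → Indep A → Indep B → ∣ A ∣ < ∣ B ∣ →
              ∃ λ x → x ∈ B × x ∉ A × Indep (A ∪ ⁅ x ⁆)

open Matroid public

IsBasis : Matroid n → Subset n → Set
IsBasis M B = Indep M B × (∀ {A} → Indep M A → B ⊆ A → A ⊆ B)

allSubsets : ∀ n → List (Subset n)
allSubsets zero    = [] ∷ []
allSubsets (suc n) = map (outside ∷_) (allSubsets n) ++ map (inside ∷_) (allSubsets n)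

∈-allSubsets : (A : Subset n) → A List.∈ allSubsets n
∈-allSubsets []            = here refl
∈-allSubsets (outside ∷ A) = ∈-++⁺ˡ (∈-map⁺ (outside ∷_) (∈-allSubsets A))
∈-allSubsets {suc n} (inside ∷ A) =
  ∈-++⁺ʳ (map (outside ∷_) (allSubsets n)) (∈-map⁺ (inside ∷_) (∈-allSubsets A))

maxIndep : Matroid n → Subset n
maxIndep {n} M = argmax ∣_∣ ⊥ (filter (face? (independents M)) (allSubsets n))

rank : Matroid n → ℕ
rank M = ∣ maxIndep M ∣

maxIndep-indep : (M : Matroid n) → Indep M (maxIndep M)
maxIndep-indep {n} M =
  argmax-all ∣_∣ {P = Indep M} (⊥-indep M) (all-filter (face? (independents M)) (allSubsets n))

∣indep∣≤rank : (M : Matroid n) → ∀ {A} → Indep M A → ∣ A ∣ ≤ rank M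
∣indep∣≤rank {n} M {A} A∈M = All.lookup
  (f[xs]≤f[argmax] {f = ∣_∣} ⊥ (filter (face? (independents M)) (allSubsets n)))
  (∈-filter⁺ (face? (independents M)) (∈-allSubsets A) A∈M)

∪-lub : ∀ {A B X : Subset n} → A ⊆ X → B ⊆ X → A ∪ B ⊆ X
∪-lub {A = A} {B} A⊆X B⊆X x∈ = [ A⊆X , B⊆X ] (x∈p∪q⁻ A B x∈)

⁅x⁆⊆ : ∀ {x} {X : Subset n} → x ∈ X → ⁅ x ⁆ ⊆ X
⁅x⁆⊆ {x = x} {X} x∈X y∈ = subst (_∈ X) (sym (x∈⁅y⁆⇒x≡y x y∈)) x∈X

-- M[X] is kept on the whole ground set; elements outside X become loops.

infixl 8 _↾_

_↾_ : Matroid n → Subset n → Matroid n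
M ↾ X = record
  { independents = independents M [ X ]
  ; ⊥-indep      = ⊥-indep M , ⊥⊆
  ; augment      = λ (A∈M , A⊆X) (B∈M , B⊆X) ∣A∣<∣B∣ →
      let x , x∈B , x∉A , Ax∈M = augment M A∈M B∈M ∣A∣<∣B∣
      in  x , x∈B , x∉A , Ax∈M , ∪-lub A⊆X (⁅x⁆⊆ (B⊆X x∈B))
  }

------------------------------------------------------------------------
-- The dual matroid

rank-↾-mono : (M : Matroid n) → ∀ {X Y} → X ⊆ Y → rank (M ↾ X) ≤ rank (M ↾ Y)
rank-↾-mono M {X} {Y} X⊆Y =
  let W∈M , W⊆X = maxIndep-indep (M ↾ X)
  in  ∣indep∣≤rank (M ↾ Y) (W∈M , ⊆-trans W⊆X X⊆Y)

rank-↾-≤ : (M : Matroid n) → ∀ X → rank (M ↾ X) ≤ rank M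
rank-↾-≤ M X = ∣indep∣≤rank M (proj₁ (maxIndep-indep (M ↾ X)))

extend : (M : Matroid n) → ∀ {I} → Indep M I →
         ∃ λ J → Indep M J × I ⊆ J × ∣ J ∣ ≡ rank M
extend M {I} I∈M = go (rank M) I I∈M (m≤n+m (rank M) ∣ I ∣)
  where
  go : ∀ k I → Indep M I → rank M ≤ ∣ I ∣ + k →
       ∃ λ J → Indep M J × I ⊆ J × ∣ J ∣ ≡ rank M
  go k I I∈M r≤ with ∣ I ∣ <? rank M
  ... | no ∣I∣≮r = I , I∈M , (λ x∈ → x∈) , ≤-antisym (∣indep∣≤rank M I∈M) (≮⇒≥ ∣I∣≮r)
  go zero I I∈M r≤ | yes ∣I∣<r =
    ⊥-elim (n≮n _ (<-≤-trans ∣I∣<r (≤-trans r≤ (≤-reflexive (+-comm ∣ I ∣ 0)))))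
  go (suc k) I I∈M r≤ | yes ∣I∣<r =
    let x , _ , x∉I , Ix∈M = augment M I∈M (maxIndep-indep M) ∣I∣<r
        I<Ix = p⊂q⇒∣p∣<∣q∣ (p⊆p∪q ⁅ x ⁆ , x , q⊆p∪q I ⁅ x ⁆ (x∈⁅x⁆ x) , x∉I)
        J , J∈M , Ix⊆J , ∣J∣≡r = go k (I ∪ ⁅ x ⁆) Ix∈M
          (≤-trans r≤ (≤-trans (≤-reflexive (+-suc ∣ I ∣ k)) (+-monoˡ-≤ k I<Ix)))
    in  J , J∈M , ⊆-trans (p⊆p∪q ⁅ x ⁆) Ix⊆J , ∣J∣≡r

∣p∪q∣≤∣p∣+∣q∣ : (p q : Subset n) → ∣ p ∪ q ∣ ≤ ∣ p ∣ + ∣ q ∣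
∣p∪q∣≤∣p∣+∣q∣ []            []            = z≤n
∣p∪q∣≤∣p∣+∣q∣ (outside ∷ p) (outside ∷ q) = ∣p∪q∣≤∣p∣+∣q∣ p q
∣p∪q∣≤∣p∣+∣q∣ (outside ∷ p) (inside  ∷ q) =
  ≤-trans (s≤s (∣p∪q∣≤∣p∣+∣q∣ p q)) (≤-reflexive (sym (+-suc ∣ p ∣ ∣ q ∣)))
∣p∪q∣≤∣p∣+∣q∣ (inside  ∷ p) (outside ∷ q) = s≤s (∣p∪q∣≤∣p∣+∣q∣ p q)
∣p∪q∣≤∣p∣+∣q∣ (inside  ∷ p) (inside  ∷ q) =
  s≤s (≤-trans (∣p∪q∣≤∣p∣+∣q∣ p q) (≤-trans (n≤1+n _) (≤-reflexive (sym (+-suc ∣ p ∣ ∣ q ∣)))))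

disjoint⇒∣p∣+∣q∣≤∣p∪q∣ : (p q : Subset n) → (∀ {x} → x ∈ p → x ∉ q) →
                         ∣ p ∣ + ∣ q ∣ ≤ ∣ p ∪ q ∣
disjoint⇒∣p∣+∣q∣≤∣p∪q∣ []            []            _ = z≤n
disjoint⇒∣p∣+∣q∣≤∣p∪q∣ (outside ∷ p) (outside ∷ q) d =
  disjoint⇒∣p∣+∣q∣≤∣p∪q∣ p q (λ x∈p x∈q → d (there x∈p) (there x∈q))
disjoint⇒∣p∣+∣q∣≤∣p∪q∣ (outside ∷ p) (inside  ∷ q) d =
  ≤-trans (≤-reflexive (+-suc ∣ p ∣ ∣ q ∣))
          (s≤s (disjoint⇒∣p∣+∣q∣≤∣p∪q∣ p q (λ x∈p x∈q → d (there x∈p) (there x∈q))))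
disjoint⇒∣p∣+∣q∣≤∣p∪q∣ (inside  ∷ p) (outside ∷ q) d =
  s≤s (disjoint⇒∣p∣+∣q∣≤∣p∪q∣ p q (λ x∈p x∈q → d (there x∈p) (there x∈q)))
disjoint⇒∣p∣+∣q∣≤∣p∪q∣ (inside  ∷ p) (inside  ∷ q) d = ⊥-elim (d here here)

-- With Y a basis of M avoiding B, and X ⊇ Y \ A a basis of M avoiding A,
-- |A| < |B| rules out B ⊆ X ∪ A by counting B ∪ Y ⊆ X ∪ A.

dual-augment : (M : Matroid n) → ∀ {A B} →
               rank (M ↾ ∁ A) ≡ rank M → rank (M ↾ ∁ B) ≡ rank M → ∣ A ∣ < ∣ B ∣ →
               ∃ λ x → x ∈ B × x ∉ A × rank (M ↾ ∁ (A ∪ ⁅ x ⁆)) ≡ rank M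
dual-augment M {A} {B} rA rB ∣A∣<∣B∣ = result
  where
  Y = maxIndep (M ↾ ∁ B)

  Y∈M : Indep M Y
  Y∈M = proj₁ (maxIndep-indep (M ↾ ∁ B))

  Y⊆∁B : Y ⊆ ∁ B
  Y⊆∁B = proj₂ (maxIndep-indep (M ↾ ∁ B))

  extension : ∃ λ X → Indep (M ↾ ∁ A) X × Y ∩ ∁ A ⊆ X × ∣ X ∣ ≡ rank (M ↾ ∁ A)
  extension = extend (M ↾ ∁ A) (down-closed (independents M) (p∩q⊆p Y (∁ A)) Y∈M , p∩q⊆q Y (∁ A))

  X = proj₁ extension

  X∈M : Indep M X
  X∈M = proj₁ (proj₁ (proj₂ extension))

  X⊆∁A : X ⊆ ∁ A
  X⊆∁A = proj₂ (proj₁ (proj₂ extension))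

  Y∖A⊆X : Y ∩ ∁ A ⊆ X
  Y∖A⊆X = proj₁ (proj₂ (proj₂ extension))

  ∣X∣≡r : ∣ X ∣ ≡ rank M
  ∣X∣≡r = trans (proj₂ (proj₂ (proj₂ extension))) rA

  B⊈X∪A : ¬ (B ⊆ X ∪ A)
  B⊈X∪A B⊆ = <-irrefl refl (<-≤-trans step (≤-trans lower (≤-trans (p⊆q⇒∣p∣≤∣q∣ B∪Y⊆) upper)))
    where
    Y⊆ : Y ⊆ X ∪ A
    Y⊆ {y} y∈Y with y ∈? A
    ... | yes y∈A = q⊆p∪q X A y∈A
    ... | no  y∉A = p⊆p∪q A (Y∖A⊆X (x∈p∩q⁺ (y∈Y , x∉p⇒x∈∁p y∉A)))

    B∪Y⊆ : B ∪ Y ⊆ X ∪ A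
    B∪Y⊆ = ∪-lub B⊆ Y⊆

    lower : ∣ B ∣ + ∣ Y ∣ ≤ ∣ B ∪ Y ∣
    lower = disjoint⇒∣p∣+∣q∣≤∣p∪q∣ B Y (λ x∈B x∈Y → x∈∁p⇒x∉p (Y⊆∁B x∈Y) x∈B)

    upper : ∣ X ∪ A ∣ ≤ ∣ X ∣ + ∣ A ∣
    upper = ∣p∪q∣≤∣p∣+∣q∣ X A

    step : ∣ X ∣ + ∣ A ∣ < ∣ B ∣ + ∣ Y ∣
    step = <-≤-trans (+-monoʳ-< ∣ X ∣ ∣A∣<∣B∣)
      (≤-reflexive (trans (+-comm ∣ X ∣ ∣ B ∣) (cong (∣ B ∣ +_) (trans ∣X∣≡r (sym rB)))))

  result : ∃ λ x → x ∈ B × x ∉ A × rank (M ↾ ∁ (A ∪ ⁅ x ⁆)) ≡ rank M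
  result with any? (λ x → (x ∈? B) ×-dec (¬? (x ∈? A) ×-dec ¬? (x ∈? X)))
  ... | yes (x , x∈B , x∉A , x∉X) = x , x∈B , x∉A ,
    ≤-antisym (rank-↾-≤ M _)
      (≤-trans (≤-reflexive (sym ∣X∣≡r)) (∣indep∣≤rank (M ↾ ∁ (A ∪ ⁅ x ⁆)) (X∈M , X⊆)))
    where
    X⊆ : X ⊆ ∁ (A ∪ ⁅ x ⁆)
    X⊆ {y} y∈X = x∉p⇒x∈∁p λ y∈ →
      [ x∈∁p⇒x∉p (X⊆∁A y∈X) , (λ y∈x → x∉X (subst (_∈ X) (x∈⁅y⁆⇒x≡y x y∈x) y∈X)) ]
      (x∈p∪q⁻ A ⁅ x ⁆ y∈)
  ... | no none = ⊥-elim (B⊈X∪A B⊆)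
    where
    B⊆ : B ⊆ X ∪ A
    B⊆ {y} y∈B with y ∈? A | y ∈? X
    ... | yes y∈A | _       = q⊆p∪q X A y∈A
    ... | no  _   | yes y∈X = p⊆p∪q A y∈X
    ... | no  y∉A | no y∉X  = ⊥-elim (none (y , y∈B , y∉A , y∉X))

dualMatroid : Matroid n → Matroid n
dualMatroid M = record
  { independents = record
    { Face        = λ A → rank (M ↾ ∁ A) ≡ rank M
    ; face?       = λ A → rank (M ↾ ∁ A) ≟ rank M
    ; down-closed = λ {A} A⊆B rB → ≤-antisym (rank-↾-≤ M (∁ A))
        (≤-trans (≤-reflexive (sym rB)) (rank-↾-mono M (p⊆q⇒∁p⊇∁q A⊆B)))
    }
  ; ⊥-indep      = ≤-antisym (rank-↾-≤ M (∁ ⊥))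
      (∣indep∣≤rank (M ↾ ∁ ⊥) (maxIndep-indep M , λ _ → x∉p⇒x∈∁p ∉⊥))
  ; augment      = dual-augment M
  }

------------------------------------------------------------------------
-- Graphs

-- A simple graph whose vertices are the elements of U satisfying IsVertex.

record Graph (U : Set) : Set₁ where
  field
    IsVertex   : Pred U 0ℓ
    Adj        : Rel U 0ℓ
    adj-vertex : ∀ {x y} → Adj x y → IsVertex x
    adj-sym    : Symmetric Adj
    adj-irrefl : ∀ {x} → ¬ Adj x x

open Graph public

Connected : {U : Set} → Graph U → Set
Connected G = (∃ λ x → IsVertex G x) ×
              (∀ x y → IsVertex G x → IsVertex G y → Star (Adj G) x y)

RG : Complex n → Matroid n → Graph (Subset n)
RG {n} D N = record
  { IsVertex   = V
  ; Adj        = λ A B → V A × V B × Face D (A ∪ B) × ∣ A ∪ B ∣ ≡ rank N + 1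
  ; adj-vertex = proj₁
  ; adj-sym    = λ {A} {B} (vA , vB , AB∈D , eq) →
      vB , vA , subst (Face D) (∪-comm A B) AB∈D , trans (cong ∣_∣ (∪-comm B A)) eq
  ; adj-irrefl = λ {A} (vA , _ , _ , eq) → n≮n (rank N)
      (≤-trans (≤-reflexive (trans (+-comm 1 (rank N)) (trans (sym eq) (cong ∣_∣ (∪-idem A)))))
               (∣indep∣≤rank N (proj₁ (proj₁ vA))))
  }
  where
  V : Subset n → Set
  V A = IsBasis N A × Face D A

{-# OPTIONS --safe #-}

-- Passing to complements, the vertices of RG (C⋆ , M*) are the bases of M
-- outside C, two of them being adjacent when they differ by one exchange and
-- their intersection is still outside C.  Bases containing a common A ∉ C are
-- linked by exchanges, so it suffices that the poset Q of independent sets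
-- outside C is nonempty and connected.
--
-- Consider pairs (A , T) with A ∉ C and T ∈ M, graded by |A| - |T|, with
-- differential removing elements from A (relative chains of (2^V , C)) and
-- adding elements to T (cochains of M).  A locally constant function on Q is a
-- cycle of degree 0 supported on the diagonal A = T, in the subcomplex A ⊆ T.
-- For J ∪ U ⊂ V let S (J , U) be the pairs with J ⊆ A, J ∩ T = ∅ and
-- A ∩ U ⊆ T.  It is exact in degrees ≥ |J|: for U = ∅ because the nonfaces
-- containing J have relative homology only in sizes ≤ |J| + d + 1 (C is d-Leray)
-- while M[V ∖ J] has cohomology only from size d + 2 on; for larger U by the
-- long exact sequence relating S (J , U ∪ u), S (J , U) and S (J ∪ u , U).
-- Moving the elements of V one by one from U to J, the same sequences embed the
-- degree 0 homology of S (∅ , V), which is that of locally constant functions on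
-- Q, into that of S (V , ∅), which is a single pair: so it has dimension ≤ 1 and
-- Q is connected; and it is nonzero, so Q is nonempty.
module Submission where

open import Defs
open import Data.Bool.Base using (Bool; true; false; not; _xor_; if_then_else_)
open import Data.Bool.Properties using () renaming (_≟_ to _≟ᵇ_)
open import Data.Empty using (⊥-elim)
open import Data.Fin.Base using (Fin; zero; suc)
import Data.Fin.Properties as Fin
open import Data.Fin.Subset using (Subset; inside; outside; ⊥; ⊤; ⁅_⁆; ⋃; _∈_; _∉_; _⊆_; _∪_; _∩_; _-_; ∁; ∣_∣)
open import Data.Fin.Subset.Properties using (drop-∷-⊆; out⊆; s⊆s; _∈?_; Empty-unique; nonempty?; ∉⊥; ⊥⊆; ∣⊥∣≡0; ∈⊤; ⊆⊤; ∣⊤∣≡n; x∈⁅x⁆; x∈⁅y⁆⇒x≡y; ∣⁅x⁆∣≡1; ⊆-refl; ⊆-reflexive; ⊆-trans; ⊆-antisym; _⊆?_; p⊆q⇒∣p∣≤∣q∣; p⊂q⇒∣p∣<∣q∣; x∈∁p⇒x∉p; x∉∁p⇒x∈p; x∉p⇒x∈∁p; p⊆q⇒∁p⊇∁q; p∩q⊆p; x∈p∩q⁺; x∈p∩q⁻; p⊆p∪q; q⊆p∪q; x∈p∪q⁻; p─q⊆p; x∈p∧x≢y⇒x∈p-y; x∈p⇒∣p-x∣<∣p∣; anySubset?; ∪-identityʳ)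
open import Data.List.Base using (List; []; _∷_; map; length; allFin)
import Data.List.Membership.DecPropositional as DecList
import Data.List.Membership.Propositional as List
open import Data.List.Membership.Propositional.Properties using (∈-allFin)
open import Data.List.Properties using (length-removeAt′; length-tabulate)
open import Data.List.Relation.Unary.All as All using (All; []; _∷_)
open import Data.List.Relation.Unary.AllPairs using ([]; _∷_)
open import Data.List.Relation.Unary.Any as Any using (Any; here; there; any?; _─_; lookup)
open import Data.List.Relation.Unary.Any.Properties using (lookup-result)
open import Data.List.Relation.Unary.Unique.Propositional using (Unique)
open import Data.List.Relation.Unary.Unique.Propositional.Properties using (allFin⁺)
open import Data.Nat.Base using (ℕ; zero; suc; _+_; _≤_; _<_; _≥_; s≤s; s≤s⁻¹)
import Data.Nat.Properties as ℕ
open import Data.Product.Base using (∃; ∃₂; _×_; _,_; proj₁; proj₂; map₁)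
open import Data.Rational.Base using (ℚ; 0ℚ; 1ℚ; _*_; -_) renaming (_+_ to _+ℚ_)
open import Data.Rational.Properties using (_≟_; +-identityˡ; +-identityʳ; +-inverseˡ; +-inverseʳ; neg-distrib-+; neg-distribˡ-*; neg-distribʳ-*; neg-injective; *-identityˡ; *-identityʳ; *-zeroʳ; *-distribˡ-+; +-0-commutativeMonoid)
open import Data.Rational.Solver using (module +-*-Solver)
open import Data.Sum.Base using (_⊎_; inj₁; inj₂; [_,_]′; swap)
open import Data.Vec.Base using ([]; _∷_; here; there; _[_]≔_)
open import Data.Vec.Properties using (≡-dec; ∷-injectiveʳ; []≔-minimal)
open import Function.Base using (_∘_; id)
open import Level using (0ℓ)
open import Relation.Binary.Construct.Closure.ReflexiveTransitive using (Star; ε; _◅_; _◅◅_)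
open import Relation.Binary.Core using (Rel)
import Relation.Binary.Definitions as B
open import Relation.Binary.PropositionalEquality using (_≡_; _≢_; refl; sym; trans; cong; cong₂; subst; module ≡-Reasoning)
open import Relation.Nullary using (¬_; Dec; does; yes; no)
open import Relation.Nullary.Decidable using (_×-dec_; _⊎-dec_; ¬?; decidable-stable)
open import Relation.Unary using (Pred; Decidable)

open import Algebra.Properties.CommutativeMonoid.Sum +-0-commutativeMonoid using (sum; sum-cong-≋)

open +-*-Solver using (solve; _:=_; _:+_; _:*_; :-_; con)
open ≡-Reasoning

private
  variable
    m n s : ℕ

-- The simplicial boundary, by recursion on the first vertex

Chain : ℕ → Set
Chain m = Subset m → ℚ

bd : Chain m → Chain m
bd c []            = 0ℚ
bd c (outside ∷ τ) = c (inside ∷ τ) +ℚ bd (c ∘ (outside ∷_)) τ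
bd c (inside  ∷ τ) = - bd (c ∘ (inside ∷_)) τ

private
  ∂-term : Chain n → Subset n → Fin n → ℚ
  ∂-term c τ v = if does (v ∈? τ) then 0ℚ else ([-1]^ (#below v τ)) * c (τ ∪ ⁅ v ⁆)

  sum-neg : ∀ {n} (f : Fin n → ℚ) → sum (λ v → - f v) ≡ - sum f
  sum-neg {zero}  f = refl
  sum-neg {suc n} f =
    trans (cong (- f zero +ℚ_) (sum-neg (f ∘ suc))) (sym (neg-distrib-+ (f zero) (sum (f ∘ suc))))

  ∂-term-inside : (c : Chain (suc n)) (τ : Subset n) (v : Fin n) →
    ∂-term c (inside ∷ τ) (suc v) ≡ - ∂-term (c ∘ (inside ∷_)) τ v
  ∂-term-inside c τ v with does (v ∈? τ)
  ... | true  = refl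
  ... | false =
    sym (neg-distribˡ-* ([-1]^ (#below v τ)) (c (inside ∷ (τ ∪ ⁅ v ⁆))))

-- Split off the summand of vertex `zero`. If `zero` lies in the set, that summand is 0 and every
-- later position moves up by one, whence the sign.
∂≡bd : (c : Chain n) (τ : Subset n) → ∂ c τ ≡ bd c τ
∂≡bd c []            = refl
∂≡bd c (outside ∷ τ) = cong₂ _+ℚ_
  (trans (*-identityˡ _) (cong (c ∘ (inside ∷_)) (∪-identityʳ τ)))
  (∂≡bd (c ∘ (outside ∷_)) τ)
∂≡bd {suc n} c (inside  ∷ τ) = begin
  0ℚ +ℚ sum (λ v → ∂-term c (inside ∷ τ) (suc v))  ≡⟨ +-identityˡ _ ⟩
  sum (λ v → ∂-term c (inside ∷ τ) (suc v))       ≡⟨ sum-cong-≋ (∂-term-inside c τ) ⟩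
  sum (λ v → - ∂-term (c ∘ (inside ∷_)) τ v)      ≡⟨ sum-neg (∂-term (c ∘ (inside ∷_)) τ) ⟩
  - ∂ (c ∘ (inside ∷_)) τ                         ≡⟨ cong -_ (∂≡bd (c ∘ (inside ∷_)) τ) ⟩
  - bd (c ∘ (inside ∷_)) τ                        ∎

bd-cong : {y z : Chain m} (σ : Subset m) →
  (∀ τ → σ ⊆ τ → ∣ τ ∣ ≡ suc ∣ σ ∣ → y τ ≡ z τ) → bd y σ ≡ bd z σ
bd-cong []            y≡z = refl
bd-cong (outside ∷ σ) y≡z = cong₂ _+ℚ_
  (y≡z (inside ∷ σ) (out⊆ ⊆-refl) refl)
  (bd-cong σ (λ τ σ⊆τ eq → y≡z (outside ∷ τ) (s⊆s σ⊆τ) eq))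
bd-cong (inside  ∷ σ) y≡z =
  cong -_ (bd-cong σ (λ τ σ⊆τ eq → y≡z (inside ∷ τ) (s⊆s σ⊆τ) (cong suc eq)))

bd-ext : {y z : Chain m} → (∀ τ → y τ ≡ z τ) → ∀ σ → bd y σ ≡ bd z σ
bd-ext y≡z σ = bd-cong σ (λ τ _ _ → y≡z τ)

bd-0 : (σ : Subset m) → bd (λ _ → 0ℚ) σ ≡ 0ℚ
bd-0 []            = refl
bd-0 (outside ∷ σ) = trans (+-identityˡ _) (bd-0 σ)
bd-0 (inside  ∷ σ) = cong -_ (bd-0 σ)

bd-≡0 : {z : Chain m} (σ : Subset m) →
  (∀ τ → σ ⊆ τ → ∣ τ ∣ ≡ suc ∣ σ ∣ → z τ ≡ 0ℚ) → bd z σ ≡ 0ℚ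
bd-≡0 σ z≡0 = trans (bd-cong σ z≡0) (bd-0 σ)

bd-+ : (y z : Chain m) (σ : Subset m) → bd (λ τ → y τ +ℚ z τ) σ ≡ bd y σ +ℚ bd z σ
bd-+ y z []            = refl
bd-+ y z (outside ∷ σ) = trans (cong (y (inside ∷ σ) +ℚ z (inside ∷ σ) +ℚ_) (bd-+ (y ∘ (outside ∷_)) (z ∘ (outside ∷_)) σ))
  (solve 4 (λ a b c d → (a :+ b) :+ (c :+ d) := (a :+ c) :+ (b :+ d)) refl
    (y (inside ∷ σ)) (z (inside ∷ σ)) (bd (y ∘ (outside ∷_)) σ) (bd (z ∘ (outside ∷_)) σ))
bd-+ y z (inside  ∷ σ) = trans (cong -_ (bd-+ (y ∘ (inside ∷_)) (z ∘ (inside ∷_)) σ))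
  (neg-distrib-+ (bd (y ∘ (inside ∷_)) σ) (bd (z ∘ (inside ∷_)) σ))

bd-* : (a : ℚ) (z : Chain m) (σ : Subset m) → bd (λ τ → a * z τ) σ ≡ a * bd z σ
bd-* a z []            = sym (*-zeroʳ a)
bd-* a z (outside ∷ σ) = trans (cong (a * z (inside ∷ σ) +ℚ_) (bd-* a (z ∘ (outside ∷_)) σ))
  (sym (*-distribˡ-+ a (z (inside ∷ σ)) (bd (z ∘ (outside ∷_)) σ)))
bd-* a z (inside  ∷ σ) = trans (cong -_ (bd-* a (z ∘ (inside ∷_)) σ))
  (neg-distribʳ-* a (bd (z ∘ (inside ∷_)) σ))

bd-neg : (z : Chain m) (σ : Subset m) → bd (λ τ → - z τ) σ ≡ - bd z σ
bd-neg z []            = refl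
bd-neg z (outside ∷ σ) = trans (cong (- z (inside ∷ σ) +ℚ_) (bd-neg (z ∘ (outside ∷_)) σ))
  (sym (neg-distrib-+ (z (inside ∷ σ)) (bd (z ∘ (outside ∷_)) σ)))
bd-neg z (inside  ∷ σ) = cong -_ (bd-neg (z ∘ (inside ∷_)) σ)

bd∘bd : (z : Chain m) (σ : Subset m) → bd (bd z) σ ≡ 0ℚ
bd∘bd z []            = refl
bd∘bd z (outside ∷ σ) = begin
  - bd z₁ σ +ℚ bd (λ τ → z₁ τ +ℚ bd z₀ τ) σ    ≡⟨ cong (- bd z₁ σ +ℚ_) (bd-+ z₁ (bd z₀) σ) ⟩
  - bd z₁ σ +ℚ (bd z₁ σ +ℚ bd (bd z₀) σ)       ≡⟨ cong (λ q → - bd z₁ σ +ℚ (bd z₁ σ +ℚ q)) (bd∘bd z₀ σ) ⟩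
  - bd z₁ σ +ℚ (bd z₁ σ +ℚ 0ℚ)                 ≡⟨ cong (- bd z₁ σ +ℚ_) (+-identityʳ (bd z₁ σ)) ⟩
  - bd z₁ σ +ℚ bd z₁ σ                        ≡⟨ +-inverseˡ (bd z₁ σ) ⟩
  0ℚ                                         ∎
  where
  z₀ = z ∘ (outside ∷_)
  z₁ = z ∘ (inside ∷_)
bd∘bd z (inside  ∷ σ) =
  cong -_ (trans (bd-neg (bd (z ∘ (inside ∷_))) σ) (cong -_ (bd∘bd (z ∘ (inside ∷_)) σ)))

-- Cones as a contracting homotopy

cone : Fin m → Chain m → Chain m
cone zero    c (outside ∷ τ) = 0ℚ
cone zero    c (inside  ∷ τ) = c (outside ∷ τ)
cone (suc p) c (outside ∷ τ) = cone p (c ∘ (outside ∷_)) τ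
cone (suc p) c (inside  ∷ τ) = - cone p (c ∘ (inside ∷_)) τ

cone-+ : (p : Fin m) (y z : Chain m) (σ : Subset m) →
  cone p (λ τ → y τ +ℚ z τ) σ ≡ cone p y σ +ℚ cone p z σ
cone-+ zero    y z (outside ∷ σ) = refl
cone-+ zero    y z (inside  ∷ σ) = refl
cone-+ (suc p) y z (outside ∷ σ) = cone-+ p (y ∘ (outside ∷_)) (z ∘ (outside ∷_)) σ
cone-+ (suc p) y z (inside  ∷ σ) = trans (cong -_ (cone-+ p (y ∘ (inside ∷_)) (z ∘ (inside ∷_)) σ))
  (neg-distrib-+ (cone p (y ∘ (inside ∷_)) σ) (cone p (z ∘ (inside ∷_)) σ))

cone-neg : (p : Fin m) (z : Chain m) (σ : Subset m) → cone p (λ τ → - z τ) σ ≡ - cone p z σ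
cone-neg zero    z (outside ∷ σ) = refl
cone-neg zero    z (inside  ∷ σ) = refl
cone-neg (suc p) z (outside ∷ σ) = cone-neg p (z ∘ (outside ∷_)) σ
cone-neg (suc p) z (inside  ∷ σ) = cong -_ (cone-neg p (z ∘ (inside ∷_)) σ)

-- `cone p` adds `p` with the sign of its position, one minus per element before it. The empty set
-- counts as a face for `bd`, so there is no correction term.
cone-homotopy : (p : Fin m) (z : Chain m) (σ : Subset m) →
  bd (cone p z) σ +ℚ cone p (bd z) σ ≡ z σ
cone-homotopy zero z (outside ∷ σ) = begin
  z (outside ∷ σ) +ℚ bd (λ _ → 0ℚ) σ +ℚ 0ℚ  ≡⟨ +-identityʳ _ ⟩
  z (outside ∷ σ) +ℚ bd (λ _ → 0ℚ) σ       ≡⟨ cong (z (outside ∷ σ) +ℚ_) (bd-0 σ) ⟩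
  z (outside ∷ σ) +ℚ 0ℚ                    ≡⟨ +-identityʳ _ ⟩
  z (outside ∷ σ)                         ∎
cone-homotopy zero z (inside  ∷ σ) =
  solve 2 (λ a b → :- b :+ (a :+ b) := a) refl (z (inside ∷ σ)) (bd (z ∘ (outside ∷_)) σ)
cone-homotopy (suc p) z (outside ∷ σ) = begin
  (- cone p z₁ σ +ℚ bd (cone p z₀) σ) +ℚ cone p (λ τ → z₁ τ +ℚ bd z₀ τ) σ
    ≡⟨ cong (- cone p z₁ σ +ℚ bd (cone p z₀) σ +ℚ_) (cone-+ p z₁ (bd z₀) σ) ⟩
  (- cone p z₁ σ +ℚ bd (cone p z₀) σ) +ℚ (cone p z₁ σ +ℚ cone p (bd z₀) σ)
    ≡⟨ solve 3 (λ a b c → (:- a :+ b) :+ (a :+ c) := b :+ c) refl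
         (cone p z₁ σ) (bd (cone p z₀) σ) (cone p (bd z₀) σ) ⟩
  bd (cone p z₀) σ +ℚ cone p (bd z₀) σ
    ≡⟨ cone-homotopy p z₀ σ ⟩
  z₀ σ ∎
  where
  z₀ = z ∘ (outside ∷_)
  z₁ = z ∘ (inside ∷_)
cone-homotopy (suc p) z (inside  ∷ σ) = begin
  - bd (λ τ → - cone p z₁ τ) σ +ℚ - cone p (λ τ → - bd z₁ τ) σ
    ≡⟨ cong₂ (λ a b → - a +ℚ - b) (bd-neg (cone p z₁) σ) (cone-neg p (bd z₁) σ) ⟩
  - - bd (cone p z₁) σ +ℚ - - cone p (bd z₁) σ
    ≡⟨ solve 2 (λ a b → :- :- a :+ :- :- b := a :+ b) refl (bd (cone p z₁) σ) (cone p (bd z₁) σ) ⟩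
  bd (cone p z₁) σ +ℚ cone p (bd z₁) σ
    ≡⟨ cone-homotopy p z₁ σ ⟩
  z₁ σ ∎
  where
  z₁ = z ∘ (inside ∷_)

cone-≡0 : (p : Fin m) (z : Chain m) (σ : Subset m) →
  (p ∈ σ → z (σ [ p ]≔ outside) ≡ 0ℚ) → cone p z σ ≡ 0ℚ
cone-≡0 zero    z (outside ∷ σ) z≡0 = refl
cone-≡0 zero    z (inside  ∷ σ) z≡0 = z≡0 here
cone-≡0 (suc p) z (outside ∷ σ) z≡0 = cone-≡0 p (z ∘ (outside ∷_)) σ (z≡0 ∘ there)
cone-≡0 (suc p) z (inside  ∷ σ) z≡0 = cong -_ (cone-≡0 p (z ∘ (inside ∷_)) σ (z≡0 ∘ there))

-- Relative chains on a convex family of subsets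

Supported : Pred (Subset m) 0ℓ → ℕ → Chain m → Set
Supported S s z = ∀ σ → ¬ (S σ × ∣ σ ∣ ≡ s) → z σ ≡ 0ℚ

-- The equation is required on `S` alone, which makes the homology relative: a convex `S` is a
-- difference of two complexes. The index `s` in the neighbouring definitions counts elements, one
-- more than the simplicial dimension.
Cycle : Pred (Subset m) 0ℓ → Chain m → Set
Cycle S z = ∀ {σ} → S σ → bd z σ ≡ 0ℚ

Bounds : Pred (Subset m) 0ℓ → ℕ → Chain m → Set
Bounds S s z = ∃ λ u → Supported S (suc s) u × (∀ {σ} → S σ → bd u σ ≡ z σ)

Exact : Pred (Subset m) 0ℓ → ℕ → Set
Exact S s = ∀ z → Supported S s z → Cycle S z → Bounds S s z

-- Dimension at most one of the homology in size `s`, phrased as linear dependence of any two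
-- classes so that no quotient space has to be formed.
Dim≤1 : Pred (Subset m) 0ℓ → ℕ → Set
Dim≤1 S s = ∀ y z → Supported S s y → Supported S s z → Cycle S y → Cycle S z →
  ∃₂ λ a b → ¬ (a ≡ 0ℚ × b ≡ 0ℚ) × Bounds S s (λ σ → a * y σ +ℚ b * z σ)

Convex : Pred (Subset m) 0ℓ → Set
Convex S = ∀ ρ σ τ → ρ ⊆ σ → σ ⊆ τ → S ρ → S τ → S σ

-- A record, unlike Relation.Unary._≐_, so that S and S′ can be inferred from it.

infix 4 _≐_
record _≐_ (S S′ : Pred (Subset m) 0ℓ) : Set where
  constructor _,≐_
  field
    to   : ∀ {σ} → S σ → S′ σ
    from : ∀ {σ} → S′ σ → S σ

open _≐_

module _ {S S′ : Pred (Subset m) 0ℓ} (S≐S′ : S ≐ S′) where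

  Supported-resp : ∀ {z} → Supported S s z → Supported S′ s z
  Supported-resp supp σ ∉S′ = supp σ (∉S′ ∘ map₁ (to S≐S′))

  Bounds-resp : ∀ {z} → Bounds S s z → Bounds S′ s z
  Bounds-resp (u , supp , bdu) = u , Supported-resp supp , (λ σ∈S′ → bdu (from S≐S′ σ∈S′))

≐-sym : {S S′ : Pred (Subset m) 0ℓ} → S ≐ S′ → S′ ≐ S
≐-sym (f ,≐ g) = g ,≐ f

Exact-resp : {S S′ : Pred (Subset m) 0ℓ} → S ≐ S′ → Exact S s → Exact S′ s
Exact-resp eq ex z supp cyc =
  Bounds-resp eq (ex z (Supported-resp (≐-sym eq) supp) (λ σ∈S → cyc (to eq σ∈S)))

Dim≤1-resp : {S S′ : Pred (Subset m) 0ℓ} → S ≐ S′ → Dim≤1 S s → Dim≤1 S′ s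
Dim≤1-resp eq dim y z suppy suppz cycy cycz =
  let a , b , ab≢0 , bounds = dim y z (Supported-resp (≐-sym eq) suppy) (Supported-resp (≐-sym eq) suppz)
                                  (λ σ∈S → cycy (to eq σ∈S)) (λ σ∈S → cycz (to eq σ∈S))
  in  a , b , ab≢0 , Bounds-resp eq bounds

Bounds-≡0 : {S : Pred (Subset m) 0ℓ} {z : Chain m} → (∀ {σ} → S σ → z σ ≡ 0ℚ) → Bounds S s z
Bounds-≡0 z≡0 = (λ _ → 0ℚ) , (λ _ _ → refl) , (λ {σ} σ∈S → trans (bd-0 σ) (sym (z≡0 σ∈S)))

exact-empty : {S : Pred (Subset m) 0ℓ} → (∀ {σ} → S σ → ∣ σ ∣ ≢ s) → Exact S s
exact-empty empty z supp _ = Bounds-≡0 (λ _ → supp _ (λ (σ∈S , size) → empty σ∈S size))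

bd-Supported : {S : Pred (Subset m) 0ℓ} {u : Chain m} → Supported S (suc s) u →
  ∀ σ → ∣ σ ∣ ≢ s → bd u σ ≡ 0ℚ
bd-Supported supp σ size≢ =
  bd-≡0 σ (λ τ _ eq → supp _ (λ (_ , eq′) → size≢ (ℕ.suc-injective (trans (sym eq) eq′))))

-- Coning with apex `p` stays inside `S`, and the homotopy term `cone p (bd z)` vanishes on `S`
-- because `bd z` does. So the cone over a cycle fills it.
exact-cone : {S : Pred (Subset m) 0ℓ} (p : Fin m) →
  (∀ {σ} b → S σ → S (σ [ p ]≔ b)) → Exact S s
exact-cone {m} {s} {S} p closed z supp cyc = cone p z , supp′ , bounds
  where
  supp′ : Supported S (suc s) (cone p z)
  supp′ σ ∉S = cone-≡0 p z σ (λ p∈σ → supp _ (λ (S- , size) →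
    ∉S (subst S (on p∈σ) (closed inside S-) , trans (card p∈σ) (cong suc size))))
    where
    on : ∀ {m} {σ : Subset m} {p} → p ∈ σ → (σ [ p ]≔ outside) [ p ]≔ inside ≡ σ
    on here       = refl
    on (there p∈) = cong (_ ∷_) (on p∈)

    card : ∀ {m} {σ : Subset m} {p} → p ∈ σ → ∣ σ ∣ ≡ suc ∣ σ [ p ]≔ outside ∣
    card                     here       = refl
    card {σ = outside ∷ _} (there p∈) = card p∈
    card {σ = inside  ∷ _} (there p∈) = cong suc (card p∈)

  bounds : ∀ {σ} → S σ → bd (cone p z) σ ≡ z σ
  bounds {σ} σ∈S = begin
    bd (cone p z) σ                    ≡⟨ +-identityʳ _ ⟨
    bd (cone p z) σ +ℚ 0ℚ               ≡⟨ cong (bd (cone p z) σ +ℚ_)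
                                            (cone-≡0 p (bd z) σ (λ _ → cyc (closed outside σ∈S))) ⟨
    bd (cone p z) σ +ℚ cone p (bd z) σ  ≡⟨ cone-homotopy p z σ ⟩
    z σ                                ∎

module _ {P : Pred (Subset m) 0ℓ} (P? : Decidable P) where

  restrict : Chain m → Chain m
  restrict z σ = if does (P? σ) then z σ else 0ℚ

  restrict-∈ : ∀ z {σ} → P σ → restrict z σ ≡ z σ
  restrict-∈ z {σ} Pσ with P? σ
  ... | yes _  = refl
  ... | no ¬Pσ = ⊥-elim (¬Pσ Pσ)

  restrict-∉ : ∀ z {σ} → ¬ P σ → restrict z σ ≡ 0ℚ
  restrict-∉ z {σ} ¬Pσ with P? σ
  ... | yes Pσ = ⊥-elim (¬Pσ Pσ)
  ... | no _   = refl

-- The long exact sequence of the pair (S , S ∖ V), in the guise of its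
-- consequences for exactness.

module Split {S V : Pred (Subset m) 0ℓ} (S? : Decidable S) (V? : Decidable V)
             (convex : Convex S) (V-up : ∀ {σ τ} → σ ⊆ τ → V σ → V τ) where

  -- As `bd` removes elements and `V` is closed upwards, `lower` carries a subcomplex and `upper`
  -- the quotient by it.
  upper lower : Pred (Subset m) 0ℓ
  upper σ = S σ × V σ
  lower σ = S σ × ¬ V σ

  private
    ∂ˢ : Chain m → Chain m
    ∂ˢ u = restrict S? (bd u)

    ∂ˢ-supported : ∀ {u} → Supported S (suc s) u → Supported S s (∂ˢ u)
    ∂ˢ-supported {u = u} supp σ ∉ with S? σ
    ... | yes σ∈S = bd-Supported supp σ (λ size → ∉ (σ∈S , size))
    ... | no  _   = refl

    -- Cutting `bd u` down to `S` loses nothing just above a member of `S`: for `τ` outside `S`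
    -- above such a member, convexity leaves no member of `S` above `τ`, so `bd u τ` is already 0.
    bd∘∂ˢ : ∀ {u} → Supported S (suc s) u → Cycle S (∂ˢ u)
    bd∘∂ˢ {u = u} supp {σ} σ∈S = trans (bd-cong σ agree) (bd∘bd u σ)
      where
      agree : ∀ τ → σ ⊆ τ → ∣ τ ∣ ≡ suc ∣ σ ∣ → ∂ˢ u τ ≡ bd u τ
      agree τ σ⊆τ _ with S? τ
      ... | yes _   = refl
      ... | no  τ∉S = sym (bd-≡0 τ (λ ρ τ⊆ρ _ → supp _ (λ (ρ∈S , _) → τ∉S (convex σ τ ρ σ⊆τ τ⊆ρ σ∈S ρ∈S))))

    lower⇒S : ∀ {z} → Supported lower s z → Supported S s z
    lower⇒S supp σ ∉ = supp _ (λ ((σ∈S , _) , size) → ∉ (σ∈S , size))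

    upper⇒S : ∀ {z} → Supported upper s z → Supported S s z
    upper⇒S supp σ ∉ = supp _ (λ ((σ∈S , _) , size) → ∉ (σ∈S , size))

    bd-lower-V : ∀ {z} → Supported lower s z → ∀ {σ} → V σ → bd z σ ≡ 0ℚ
    bd-lower-V supp {σ} σ∈V = bd-≡0 σ (λ τ σ⊆τ _ → supp _ (λ ((_ , τ∉V) , _) → τ∉V (V-up σ⊆τ σ∈V)))

    restrict-V : ∀ {z} → Supported S s z → Supported upper s (restrict V? z)
    restrict-V {z = z} supp σ ∉ with V? σ
    ... | yes σ∈V = supp _ (λ (σ∈S , size) → ∉ ((σ∈S , σ∈V) , size))
    ... | no  _   = refl

    bd-restrict-V : ∀ z {σ} → V σ → bd (restrict V? z) σ ≡ bd z σ
    bd-restrict-V z {σ} σ∈V = bd-cong σ (λ τ σ⊆τ _ → restrict-∈ V? z (V-up σ⊆τ σ∈V))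

    -‿supported : ∀ {P : Pred (Subset m) 0ℓ} {y z} → Supported P s y → Supported P s z →
                  Supported P s (λ σ → y σ +ℚ - z σ)
    -‿supported suppy suppz σ ∉ = cong₂ (λ a b → a +ℚ - b) (suppy σ ∉) (suppz σ ∉)

    bd-- : ∀ (y z : Chain m) σ → bd (λ τ → y τ +ℚ - z τ) σ ≡ bd y σ +ℚ - bd z σ
    bd-- y z σ = trans (bd-+ y (λ τ → - z τ) σ) (cong (bd y σ +ℚ_) (bd-neg z σ))

    to-lower : ∀ {z} → Supported S s z → (∀ {σ} → S σ → V σ → z σ ≡ 0ℚ) → Supported lower s z
    to-lower supp z≡0 σ ∉ with V? σ | S? σ
    ... | yes σ∈V | yes σ∈S = z≡0 σ∈S σ∈V
    ... | yes _   | no  σ∉S = supp _ (λ (σ∈S , _) → σ∉S σ∈S)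
    ... | no  σ∉V | _       = supp _ (λ (σ∈S , size) → ∉ ((σ∈S , σ∉V) , size))

    x-0 : ∀ x → x +ℚ - 0ℚ ≡ x
    x-0 = +-identityʳ

  -- Fill the quotient part of the cycle in `upper`. Subtracting the relative boundary of that
  -- filling leaves a cycle on `lower`, which is filled in turn.
  exact-middle : Exact lower s → Exact upper s → Exact S s
  exact-middle {s} exact-lower exact-upper z supp cyc = u , supp-u , bounds
    where
    filled-upper : Bounds upper s (restrict V? z)
    filled-upper = exact-upper (restrict V? z) (restrict-V supp)
      (λ (σ∈S , σ∈V) → trans (bd-restrict-V z σ∈V) (cyc σ∈S))

    u₁ = proj₁ filled-upper
    supp-u₁ = upper⇒S (proj₁ (proj₂ filled-upper))

    bd-u₁ : ∀ {σ} → S σ → V σ → bd u₁ σ ≡ z σ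
    bd-u₁ σ∈S σ∈V = trans (proj₂ (proj₂ filled-upper) (σ∈S , σ∈V)) (restrict-∈ V? z σ∈V)

    y : Chain m
    y σ = z σ +ℚ - ∂ˢ u₁ σ

    filled-lower : Bounds lower s y
    filled-lower = exact-lower y
      (to-lower (-‿supported supp (∂ˢ-supported supp-u₁)) (λ {σ} σ∈S σ∈V →
        trans (cong (λ q → z σ +ℚ - q) (trans (restrict-∈ S? (bd u₁) σ∈S) (bd-u₁ σ∈S σ∈V))) (+-inverseʳ (z σ))))
      (λ {σ} (σ∈S , _) → trans (bd-- z (∂ˢ u₁) σ)
        (cong₂ (λ a b → a +ℚ - b) (cyc σ∈S) (bd∘∂ˢ supp-u₁ σ∈S)))

    u₀ = proj₁ filled-lower
    supp-u₀ = proj₁ (proj₂ filled-lower)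

    u : Chain m
    u σ = u₀ σ +ℚ u₁ σ

    supp-u : Supported S (suc s) u
    supp-u σ ∉ = cong₂ _+ℚ_ (lower⇒S supp-u₀ σ ∉) (supp-u₁ σ ∉)

    bounds : ∀ {σ} → S σ → bd u σ ≡ z σ
    bounds {σ} σ∈S with V? σ
    ... | yes σ∈V = trans (bd-+ u₀ u₁ σ)
      (trans (cong₂ _+ℚ_ (bd-lower-V supp-u₀ σ∈V) (bd-u₁ σ∈S σ∈V)) (+-identityˡ (z σ)))
    ... | no  σ∉V = begin
      bd u σ                             ≡⟨ bd-+ u₀ u₁ σ ⟩
      bd u₀ σ +ℚ bd u₁ σ                  ≡⟨ cong (_+ℚ bd u₁ σ) (proj₂ (proj₂ filled-lower) (σ∈S , σ∉V)) ⟩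
      z σ +ℚ - ∂ˢ u₁ σ +ℚ bd u₁ σ          ≡⟨ cong (λ q → z σ +ℚ - q +ℚ bd u₁ σ) (restrict-∈ S? (bd u₁) σ∈S) ⟩
      z σ +ℚ - bd u₁ σ +ℚ bd u₁ σ          ≡⟨ solve 2 (λ a b → a :+ :- b :+ b := a) refl (z σ) (bd u₁ σ) ⟩
      z σ                                ∎

  -- The boundary of a quotient cycle `z` is a cycle on `lower`. Subtracting a filling `w` of it
  -- corrects `z` to a cycle of `S` with the same values on `upper`.
  exact-upper : Exact S (suc s) → Exact lower s → Exact upper (suc s)
  exact-upper {s} exact-S exact-lower z supp cyc =
    restrict V? u , restrict-V supp-u , λ {σ} (σ∈S , σ∈V) → begin
      bd (restrict V? u) σ  ≡⟨ bd-restrict-V u σ∈V ⟩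
      bd u σ                ≡⟨ proj₂ (proj₂ filled-S) σ∈S ⟩
      z σ +ℚ - w σ           ≡⟨ cong (λ q → z σ +ℚ - q) (supp-w _ (λ ((_ , σ∉V) , _) → σ∉V σ∈V)) ⟩
      z σ +ℚ - 0ℚ            ≡⟨ x-0 (z σ) ⟩
      z σ                   ∎
    where
    supp-S : Supported S (suc s) z
    supp-S = upper⇒S supp

    filled-lower : Bounds lower s (∂ˢ z)
    filled-lower = exact-lower (∂ˢ z)
      (to-lower (∂ˢ-supported supp-S)
        (λ σ∈S σ∈V → trans (restrict-∈ S? (bd z) σ∈S) (cyc (σ∈S , σ∈V))))
      (λ (σ∈S , _) → bd∘∂ˢ supp-S σ∈S)

    w = proj₁ filled-lower
    supp-w = proj₁ (proj₂ filled-lower)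

    cycle : Cycle S (λ σ → z σ +ℚ - w σ)
    cycle {σ} σ∈S with V? σ
    ... | yes σ∈V = trans (bd-- z w σ)
      (cong₂ (λ a b → a +ℚ - b) (cyc (σ∈S , σ∈V)) (bd-lower-V supp-w σ∈V))
    ... | no  σ∉V = trans (bd-- z w σ) (trans
      (cong (λ q → bd z σ +ℚ - q) (trans (proj₂ (proj₂ filled-lower) (σ∈S , σ∉V)) (restrict-∈ S? (bd z) σ∈S)))
      (+-inverseʳ (bd z σ)))

    filled-S : Bounds S (suc s) (λ σ → z σ +ℚ - w σ)
    filled-S = exact-S _ (-‿supported supp-S (lower⇒S supp-w)) cycle

    u = proj₁ filled-S
    supp-u = proj₁ (proj₂ filled-S)

  private
    cycle-S : ∀ {z} → Supported lower s z → Cycle lower z → Cycle S z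
    cycle-S supp cyc {σ} σ∈S with V? σ
    ... | yes σ∈V = bd-lower-V supp σ∈V
    ... | no  σ∉V = cyc (σ∈S , σ∉V)

    cycle-upper : ∀ {z u} → Supported lower s z → (∀ {σ} → S σ → bd u σ ≡ z σ) →
                  Cycle upper (restrict V? u)
    cycle-upper {u = u} supp bdu (σ∈S , σ∈V) = trans (bd-restrict-V u σ∈V)
      (trans (bdu σ∈S) (supp _ (λ ((_ , σ∉V) , _) → σ∉V σ∈V)))

    -- If the part on `V` of a filling `u` is the boundary of `w` in `upper`, subtracting the
    -- relative boundary of `w` clears `u` on `V` without changing its own boundary.
    bounds-lower : ∀ {z u} → Supported S (suc s) u → (∀ {σ} → S σ → bd u σ ≡ z σ) →
                   Bounds upper (suc s) (restrict V? u) → Bounds lower s z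
    bounds-lower {z = z} {u} supp bdu (w , supp-w , bdw) =
      (λ σ → u σ +ℚ - ∂ˢ w σ) ,
      to-lower (-‿supported supp (∂ˢ-supported (upper⇒S supp-w))) (λ {σ} σ∈S σ∈V →
        trans (cong (λ q → u σ +ℚ - q) (trans (restrict-∈ S? (bd w) σ∈S)
                (trans (bdw (σ∈S , σ∈V)) (restrict-∈ V? u σ∈V))))
              (+-inverseʳ (u σ))) ,
      λ {σ} (σ∈S , σ∉V) → trans (bd-- u (∂ˢ w) σ)
        (trans (cong₂ (λ a b → a +ℚ - b) (bdu σ∈S) (bd∘∂ˢ (upper⇒S supp-w) σ∈S)) (x-0 (z σ)))

  exact-lower : Exact S s → Exact upper (suc s) → Exact lower s
  exact-lower exact-S exact-upper z supp cyc =
    let u , supp-u , bdu = exact-S z (lower⇒S supp) (cycle-S supp cyc)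
    in  bounds-lower supp-u bdu
          (exact-upper (restrict V? u) (restrict-V supp-u) (cycle-upper supp bdu))

  -- Exactness of `S` makes the connecting map from `upper` to `lower` surjective, so a linear
  -- relation between lifts of two classes descends to the classes.
  dim≤1-lower : Exact S s → Dim≤1 upper (suc s) → Dim≤1 lower s
  dim≤1-lower {s} exact-S dim y z supp-y supp-z cyc-y cyc-z =
    let u , supp-u , bdu = exact-S y (lower⇒S supp-y) (cycle-S supp-y cyc-y)
        v , supp-v , bdv = exact-S z (lower⇒S supp-z) (cycle-S supp-z cyc-z)
        a , b , ab≢0 , bounds = dim (restrict V? u) (restrict V? v) (restrict-V supp-u) (restrict-V supp-v)
                                  (cycle-upper supp-y bdu) (cycle-upper supp-z bdv)
    in  a , b , ab≢0 , bounds-lower {u = λ σ → a * u σ +ℚ b * v σ}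
          (λ σ ∉ → trans (cong₂ (λ q r → a * q +ℚ b * r) (supp-u σ ∉) (supp-v σ ∉)) (vanish a b))
          (λ {σ} σ∈S → trans (bd-+ (λ τ → a * u τ) (λ τ → b * v τ) σ)
            (cong₂ _+ℚ_ (trans (bd-* a u σ) (cong (a *_) (bdu σ∈S))) (trans (bd-* b v σ) (cong (b *_) (bdv σ∈S)))))
          (Bounds-≗ (restrict-comb a b u v) bounds)
    where
    vanish : ∀ a b → a * 0ℚ +ℚ b * 0ℚ ≡ 0ℚ
    vanish a b = cong₂ _+ℚ_ (*-zeroʳ a) (*-zeroʳ b)

    restrict-comb : ∀ a b u v σ →
      a * restrict V? u σ +ℚ b * restrict V? v σ ≡ restrict V? (λ τ → a * u τ +ℚ b * v τ) σ
    restrict-comb a b u v σ with does (V? σ)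
    ... | true  = refl
    ... | false = vanish a b

    Bounds-≗ : ∀ {P : Pred (Subset m) 0ℓ} {t y z} → (∀ σ → y σ ≡ z σ) → Bounds P t y → Bounds P t z
    Bounds-≗ y≡z (w , supp , bdw) = w , supp , λ {σ} σ∈P → trans (bdw σ∈P) (y≡z σ)

-- Subsets

infix 4 _≟ˢ_
_≟ˢ_ : (p q : Subset n) → Dec (p ≡ q)
_≟ˢ_ = ≡-dec _≟ᵇ_

x∉p-x : (p : Subset n) (x : Fin n) → x ∉ p - x
x∉p-x (_ ∷ p) zero    ()
x∉p-x (_ ∷ p) (suc x) (there x∈) = x∉p-x p x x∈

x∈p[v]≔b⁻ : (p : Subset n) {x v : Fin n} {b : _} → x ∈ p [ v ]≔ b → x ≡ v ⊎ x ∈ p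
x∈p[v]≔b⁻ (_ ∷ p) {v = zero}  here       = inj₁ refl
x∈p[v]≔b⁻ (_ ∷ p) {v = zero}  (there x∈) = inj₂ (there x∈)
x∈p[v]≔b⁻ (_ ∷ p) {v = suc v} here       = inj₂ here
x∈p[v]≔b⁻ (_ ∷ p) {v = suc v} (there x∈) with x∈p[v]≔b⁻ p x∈
... | inj₁ x≡v = inj₁ (cong suc x≡v)
... | inj₂ x∈p = inj₂ (there x∈p)

[]≔-⊆ : ∀ {p X : Subset n} {v b} → v ∈ X → p ⊆ X → p [ v ]≔ b ⊆ X
[]≔-⊆ {p = p} v∈X p⊆X x∈ with x∈p[v]≔b⁻ p x∈
... | inj₁ refl = v∈X
... | inj₂ x∈p  = p⊆X x∈p

∣p∣+∣∁p∣≡n : (p : Subset n) → ∣ p ∣ + ∣ ∁ p ∣ ≡ n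
∣p∣+∣∁p∣≡n []            = refl
∣p∣+∣∁p∣≡n (inside  ∷ p) = cong suc (∣p∣+∣∁p∣≡n p)
∣p∣+∣∁p∣≡n (outside ∷ p) = trans (ℕ.+-suc ∣ p ∣ ∣ ∁ p ∣) (cong suc (∣p∣+∣∁p∣≡n p))

∁-involutive : (p : Subset n) → ∁ (∁ p) ≡ p
∁-involutive []            = refl
∁-involutive (inside  ∷ p) = cong (inside ∷_) (∁-involutive p)
∁-involutive (outside ∷ p) = cong (outside ∷_) (∁-involutive p)

⊆∧∣≥∣⇒⊇ : {p q : Subset n} → p ⊆ q → ∣ q ∣ ≤ ∣ p ∣ → q ⊆ p
⊆∧∣≥∣⇒⊇ {p = p} {q} p⊆q ∣q∣≤∣p∣ {x} x∈q with x ∈? p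
... | yes x∈p = x∈p
... | no  x∉p = ⊥-elim (ℕ.<⇒≱ (p⊂q⇒∣p∣<∣q∣ (p⊆q , x , x∈q , x∉p)) ∣q∣≤∣p∣)

⊆[]≔inside : (p : Subset n) (v : Fin n) → p ⊆ p [ v ]≔ inside
⊆[]≔inside (_ ∷ p) zero    here       = here
⊆[]≔inside (_ ∷ p) zero    (there x∈) = there x∈
⊆[]≔inside (_ ∷ p) (suc v) here       = here
⊆[]≔inside (_ ∷ p) (suc v) (there x∈) = there (⊆[]≔inside p v x∈)

-- Nonfaces of a Leray complex

fromList : List (Fin n) → Subset n
fromList js = ⋃ (map ⁅_⁆ js)

module _ (C : Complex n) where

  Nonface : Subset n → Subset n → Pred (Subset n) 0ℓ
  Nonface J X A = ¬ Face C A × J ⊆ A × A ⊆ X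

  module _ (d : ℕ) (leray : Leray d C) where

    private
      IsChain⇒Supported : ∀ {X i z} → IsChain (C [ X ]) i z → Supported (Face (C [ X ])) (suc i) z
      IsChain⇒Supported {z = z} chain σ ∉ = decidable-stable (z σ ≟ 0ℚ) (λ z≢0 → ∉ (chain σ z≢0))

      Supported⇒IsChain : ∀ {X i z} → Supported (Face (C [ X ])) (suc i) z → IsChain (C [ X ]) i z
      Supported⇒IsChain {X} {i} supp σ z≢0 =
        decidable-stable (face? (C [ X ]) σ ×-dec (∣ σ ∣ ℕ.≟ suc i)) (λ ∉ → z≢0 (supp σ ∉))

    exact-faces : ∀ X {i} → d ≤ i → Exact (Face (C [ X ])) (suc i)
    exact-faces X {i} d≤i z supp cyc =
      let w , chain , ∂w = leray X i d≤i z (Supported⇒IsChain supp , λ τ → trans (∂≡bd z τ) (bd-z τ))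
      in  w , IsChain⇒Supported chain , λ {σ} _ → trans (sym (∂≡bd w σ)) (∂w σ)
      where
      -- `IsCycle` asks for a zero boundary at every set. Off the complex this is automatic, since
      -- no face contains `τ`.
      bd-z : ∀ τ → bd z τ ≡ 0ℚ
      bd-z τ with face? (C [ X ]) τ
      ... | yes τ∈ = cyc τ∈
      ... | no  τ∉ = bd-≡0 τ (λ ρ τ⊆ρ _ → supp ρ (λ (ρ∈ , _) → τ∉ (down-closed (C [ X ]) τ⊆ρ ρ∈)))

    -- With no prescribed vertices this is the sequence of the full simplex on `X` modulo `C [ X ]`,
    -- which raises sizes by one: the Leray condition starts at size `d + 1`, so nonfaces are exact
    -- from `d + 2`. Nonfaces through a prescribed `v` are the quotient of all nonfaces by those
    -- inside `X - v`, and the threshold rises by one again.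
    exact-nonfaces : ∀ js X {s} → length js + (2 + d) ≤ s → Exact (Nonface (fromList js) X) s
    exact-nonfaces [] X {suc (suc i)} (s≤s (s≤s d≤i)) = Exact-resp {S = λ A → A ⊆ X × ¬ Face C A} {S′ = Nonface ⊥ X}
      ((λ (A⊆X , A∉C) → A∉C , ⊥⊆ , A⊆X) ,≐ (λ (A∉C , _ , A⊆X) → A⊆X , A∉C))
      (Split.exact-upper {S = _⊆ X} {V = ¬_ ∘ Face C} (_⊆? X) (¬? ∘ face? C) (λ _ _ _ _ A⊆B _ B⊆X → ⊆-trans A⊆B B⊆X)
        (λ A⊆B A∉C B∈C → A∉C (down-closed C A⊆B B∈C))
        exact-simplex
        (Exact-resp {S = Face (C [ X ])} {S′ = λ A → A ⊆ X × ¬ ¬ Face C A}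
          ((λ (A∈C , A⊆X) → A⊆X , λ A∉C → A∉C A∈C) ,≐
           (λ {A} (A⊆X , ¬A∉C) → decidable-stable (face? C A) ¬A∉C , A⊆X))
          (exact-faces X d≤i)))
      where
      exact-simplex : Exact (_⊆ X) (suc (suc i))
      exact-simplex with nonempty? X
      ... | yes (v , v∈X) = exact-cone {S = _⊆ X} v (λ {σ} b σ⊆X → []≔-⊆ {p = σ} v∈X σ⊆X)
      -- An empty `X` offers no apex, but its only subset has size 0 and the size here is at least
      -- 2.
      ... | no  empty     = exact-empty {S = _⊆ X} λ {σ} σ⊆X eq → ℕ.1+n≢0 (ℕ.n≤0⇒n≡0
        (subst (_≤ 0) eq (subst (∣ σ ∣ ≤_) (trans (cong ∣_∣ (Empty-unique empty)) (∣⊥∣≡0 n)) (p⊆q⇒∣p∣≤∣q∣ σ⊆X))))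
    exact-nonfaces (v ∷ js) X {suc s} (s≤s len≤s) = Exact-resp {S = λ A → Nonface J X A × v ∈ A} {S′ = Nonface (⁅ v ⁆ ∪ J) X}
      ((λ ((A∉C , J⊆A , A⊆X) , v∈A) → A∉C , ∪-lub (⁅x⁆⊆ v∈A) J⊆A , A⊆X) ,≐
       (λ (A∉C , vJ⊆A , A⊆X) →
         (A∉C , ⊆-trans (q⊆p∪q ⁅ v ⁆ J) vJ⊆A , A⊆X) , vJ⊆A (p⊆p∪q J (x∈⁅x⁆ v))))
      (Split.exact-upper {S = Nonface J X} {V = v ∈_}
        (λ A → ¬? (face? C A) ×-dec (J ⊆? A) ×-dec (A ⊆? X)) (v ∈?_)
        (λ _ _ _ A⊆B B⊆D (A∉C , J⊆A , _) (_ , _ , D⊆X) →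
          (λ B∈C → A∉C (down-closed C A⊆B B∈C)) , ⊆-trans J⊆A A⊆B , ⊆-trans B⊆D D⊆X)
        (λ A⊆B v∈A → A⊆B v∈A)
        (exact-nonfaces js X (ℕ.≤-trans len≤s (ℕ.n≤1+n s)))
        (Exact-resp {S = Nonface J (X - v)} {S′ = λ A → Nonface J X A × v ∉ A}
          ((λ (A∉C , J⊆A , A⊆X-v) →
             (A∉C , J⊆A , ⊆-trans A⊆X-v (p─q⊆p X ⁅ v ⁆)) , (λ v∈A → x∉p-x X v (A⊆X-v v∈A))) ,≐
           (λ ((A∉C , J⊆A , A⊆X) , v∉A) →
             A∉C , J⊆A , λ x∈A → x∈p∧x≢y⇒x∈p-y (A⊆X x∈A) λ { refl → v∉A x∈A }))
          (exact-nonfaces js (X - v) len≤s)))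
      where
      J = fromList js

-- Pairs of subsets

-- A pair (A , R) of subsets of Fin n is stored as a subset of Fin (double n),
-- with the two bits of each element next to each other.

double : ℕ → ℕ
double zero    = zero
double (suc n) = suc (suc (double n))

lft rgt : Subset (double n) → Subset n
lft {zero}  σ           = []
lft {suc n} (a ∷ r ∷ σ) = a ∷ lft σ
rgt {zero}  σ           = []
rgt {suc n} (a ∷ r ∷ σ) = r ∷ rgt σ

pair : Subset n → Subset n → Subset (double n)
pair []      []      = []
pair (a ∷ A) (r ∷ R) = a ∷ r ∷ pair A R

pair-η : (σ : Subset (double n)) → pair (lft σ) (rgt σ) ≡ σ
pair-η {zero}  []          = refl
pair-η {suc n} (a ∷ r ∷ σ) = cong (λ τ → a ∷ r ∷ τ) (pair-η σ)

lft-pair : (A R : Subset n) → lft (pair A R) ≡ A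
lft-pair []      []      = refl
lft-pair (a ∷ A) (r ∷ R) = cong (a ∷_) (lft-pair A R)

rgt-pair : (A R : Subset n) → rgt (pair A R) ≡ R
rgt-pair []      []      = refl
rgt-pair (a ∷ A) (r ∷ R) = cong (r ∷_) (rgt-pair A R)

∣σ∣≡∣lft∣+∣rgt∣ : (σ : Subset (double n)) → ∣ σ ∣ ≡ ∣ lft σ ∣ + ∣ rgt σ ∣
∣σ∣≡∣lft∣+∣rgt∣ {zero}  []                      = refl
∣σ∣≡∣lft∣+∣rgt∣ {suc n} (outside ∷ outside ∷ σ) = ∣σ∣≡∣lft∣+∣rgt∣ σ
∣σ∣≡∣lft∣+∣rgt∣ {suc n} (outside ∷ inside  ∷ σ) =
  trans (cong suc (∣σ∣≡∣lft∣+∣rgt∣ σ)) (sym (ℕ.+-suc ∣ lft σ ∣ ∣ rgt σ ∣))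
∣σ∣≡∣lft∣+∣rgt∣ {suc n} (inside  ∷ outside ∷ σ) = cong suc (∣σ∣≡∣lft∣+∣rgt∣ σ)
∣σ∣≡∣lft∣+∣rgt∣ {suc n} (inside  ∷ inside  ∷ σ) =
  cong suc (trans (cong suc (∣σ∣≡∣lft∣+∣rgt∣ σ)) (sym (ℕ.+-suc ∣ lft σ ∣ ∣ rgt σ ∣)))

lftIx rgtIx : Fin n → Fin (double n)
lftIx zero    = zero
lftIx (suc v) = suc (suc (lftIx v))
rgtIx zero    = suc zero
rgtIx (suc v) = suc (suc (rgtIx v))

lft-mono : {σ τ : Subset (double n)} → σ ⊆ τ → lft σ ⊆ lft τ
lft-mono {suc n} {a ∷ r ∷ σ} {b ∷ q ∷ τ} σ⊆τ {zero}  here with here ← σ⊆τ here = here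
lft-mono {suc n} {a ∷ r ∷ σ} {b ∷ q ∷ τ} σ⊆τ {suc x} (there x∈) =
  there (lft-mono (drop-∷-⊆ (drop-∷-⊆ σ⊆τ)) x∈)

rgt-mono : {σ τ : Subset (double n)} → σ ⊆ τ → rgt σ ⊆ rgt τ
rgt-mono {suc n} {a ∷ r ∷ σ} {b ∷ q ∷ τ} σ⊆τ {zero}  here with there here ← σ⊆τ (there here) = here
rgt-mono {suc n} {a ∷ r ∷ σ} {b ∷ q ∷ τ} σ⊆τ {suc x} (there x∈) =
  there (rgt-mono (drop-∷-⊆ (drop-∷-⊆ σ⊆τ)) x∈)

lft-lftIx : (σ : Subset (double n)) (v : Fin n) {b : _} → lft (σ [ lftIx v ]≔ b) ≡ lft σ [ v ]≔ b
lft-lftIx {suc n} (a ∷ r ∷ σ) zero    = refl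
lft-lftIx {suc n} (a ∷ r ∷ σ) (suc v) = cong (a ∷_) (lft-lftIx σ v)

rgt-lftIx : (σ : Subset (double n)) (v : Fin n) {b : _} → rgt (σ [ lftIx v ]≔ b) ≡ rgt σ
rgt-lftIx {suc n} (a ∷ r ∷ σ) zero    = refl
rgt-lftIx {suc n} (a ∷ r ∷ σ) (suc v) = cong (r ∷_) (rgt-lftIx σ v)

lft-rgtIx : (σ : Subset (double n)) (v : Fin n) {b : _} → lft (σ [ rgtIx v ]≔ b) ≡ lft σ
lft-rgtIx {suc n} (a ∷ r ∷ σ) zero    = refl
lft-rgtIx {suc n} (a ∷ r ∷ σ) (suc v) = cong (a ∷_) (lft-rgtIx σ v)

rgt-rgtIx : (σ : Subset (double n)) (v : Fin n) {b : _} → rgt (σ [ rgtIx v ]≔ b) ≡ rgt σ [ v ]≔ b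
rgt-rgtIx {suc n} (a ∷ r ∷ σ) zero    = refl
rgt-rgtIx {suc n} (a ∷ r ∷ σ) (suc v) = cong (r ∷_) (rgt-rgtIx σ v)

-- Signs, and exactness of fibres over a fixed second coordinate

flip : Bool → ℚ → ℚ
flip true  q = - q
flip false q = q

flip-0 : ∀ b → flip b 0ℚ ≡ 0ℚ
flip-0 true  = refl
flip-0 false = refl

flip-involutive : ∀ b q → flip b (flip b q) ≡ q
flip-involutive true  q = solve 1 (λ q → :- :- q := q) refl q
flip-involutive false q = refl

flip-xor : ∀ b c q → flip (b xor c) q ≡ flip b (flip c q)
flip-xor true  true  q = sym (flip-involutive true q)
flip-xor true  false q = refl
flip-xor false c     q = refl

bd-flip : ∀ b (z : Chain m) σ → bd (λ τ → flip b (z τ)) σ ≡ flip b (bd z σ)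
bd-flip true  z σ = bd-neg z σ
bd-flip false z σ = refl

parity : Subset n → Bool
parity []            = false
parity (outside ∷ R) = parity R
parity (inside  ∷ R) = not (parity R)

-- The sign of moving every element a of A past the elements of R from a on.

twist : Subset n → Subset n → Bool
twist []      []            = false
twist (r ∷ R) (outside ∷ A) = twist R A
twist (r ∷ R) (inside  ∷ A) = parity (r ∷ R) xor twist R A

twisted : Subset n → Chain (double n) → Chain n
twisted R z B = flip (twist R B) (z (pair B R))

-- In the interleaved order the sign of removing `a` also counts the elements of `R` before `a`.
-- Their parity combines that of `R` with that of `R` from `a` on, and the latter is the change in
-- `twist` when `a` joins `A`. Hence the factor `parity R xor twist R A`.
bd-fibre : (R A : Subset n) (z : Chain (double n)) → (∀ τ → rgt τ ≢ R → z τ ≡ 0ℚ) →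
  bd z (pair A R) ≡ flip (parity R xor twist R A) (bd (twisted R z) A)
bd-fibre []            []            z z≡0 = refl
bd-fibre (outside ∷ R) (outside ∷ A) z z≡0 = trans
  (cong₂ (λ p q → z (inside ∷ outside ∷ pair A R) +ℚ (p +ℚ q)) (z≡0 _ λ ())
    (bd-fibre R A _ (λ τ R≢ → z≡0 _ (R≢ ∘ ∷-injectiveʳ))))
  (lemma (parity R xor twist R A) _ _)
  where
  lemma : ∀ b x y → x +ℚ (0ℚ +ℚ flip b y) ≡ flip b (flip b x +ℚ y)
  lemma true  x y = solve 2 (λ x y → x :+ (con 0ℚ :+ :- y) := :- (:- x :+ y)) refl x y
  lemma false x y = cong (x +ℚ_) (+-identityˡ y)
bd-fibre (outside ∷ R) (inside  ∷ A) z z≡0 = trans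
  (cong₂ (λ p q → - (p +ℚ q)) (z≡0 _ λ ())
    (bd-fibre R A z₁₀ (λ τ R≢ → z≡0 _ (R≢ ∘ ∷-injectiveʳ))))
  (trans (lemma (parity R) (twist R A) _)
    (cong (λ q → flip (parity R xor (parity R xor twist R A)) (- q))
      (sym (trans (bd-ext (λ B → flip-xor (parity R) (twist R B) (z₁₀ (pair B R))) A)
                  (bd-flip (parity R) (twisted R z₁₀) A)))))
  where
  z₁₀ : Chain _
  z₁₀ τ = z (inside ∷ outside ∷ τ)
  lemma : ∀ b c y → - (0ℚ +ℚ flip (b xor c) y) ≡ flip (b xor (b xor c)) (- flip b y)
  lemma true  true  y = solve 1 (λ y → :- (con 0ℚ :+ y) := :- :- :- y) refl y
  lemma true  false y = solve 1 (λ y → :- (con 0ℚ :+ :- y) := :- :- y) refl y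
  lemma false c     y = trans (cong -_ (+-identityˡ (flip c y))) (neg-flip c)
    where
    neg-flip : ∀ c → - flip c y ≡ flip c (- y)
    neg-flip true  = refl
    neg-flip false = refl
bd-fibre (inside  ∷ R) (outside ∷ A) z z≡0 = trans
  (cong (λ q → z (inside ∷ inside ∷ pair A R) +ℚ - q)
    (bd-fibre R A _ (λ τ R≢ → z≡0 _ (R≢ ∘ ∷-injectiveʳ))))
  (lemma (parity R) (twist R A) _ _)
  where
  lemma : ∀ b c x y → x +ℚ - flip (b xor c) y ≡ flip (not b xor c) (flip (not b xor c) x +ℚ y)
  lemma true  true  x y = solve 2 (λ x y → x :+ :- y := :- (:- x :+ y)) refl x y
  lemma true  false x y = solve 2 (λ x y → x :+ :- :- y := x :+ y) refl x y
  lemma false true  x y = solve 2 (λ x y → x :+ :- :- y := x :+ y) refl x y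
  lemma false false x y = solve 2 (λ x y → x :+ :- y := :- (:- x :+ y)) refl x y
bd-fibre (inside  ∷ R) (inside  ∷ A) z z≡0 = trans
  (cong (λ q → - - q) (bd-fibre R A z₁₁ (λ τ R≢ → z≡0 _ (R≢ ∘ ∷-injectiveʳ))))
  (trans (lemma (parity R) (twist R A) _)
    (cong (λ q → flip (not (parity R) xor (not (parity R) xor twist R A)) (- q))
      (sym (trans (bd-ext (λ B → flip-xor (not (parity R)) (twist R B) (z₁₁ (pair B R))) A)
                  (bd-flip (not (parity R)) (twisted R z₁₁) A)))))
  where
  z₁₁ : Chain _
  z₁₁ τ = z (inside ∷ inside ∷ τ)
  lemma : ∀ b c y → - - flip (b xor c) y ≡ flip (not b xor (not b xor c)) (- flip (not b) y)
  lemma true  true  y = solve 1 (λ y → :- :- y := :- :- y) refl y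
  lemma true  false y = solve 1 (λ y → :- :- :- y := :- y) refl y
  lemma false true  y = solve 1 (λ y → :- :- :- y := :- :- :- y) refl y
  lemma false false y = refl

Fibre : Pred (Subset n) 0ℓ → Subset n → Pred (Subset (double n)) 0ℓ
Fibre S R σ = S (lft σ) × rgt σ ≡ R

exact-fibre : {S : Pred (Subset n) 0ℓ} (R : Subset n) → Exact S s → Exact (Fibre S R) (s + ∣ R ∣)
exact-fibre {n} {s} {S} R exact z supp cyc = u , supp-u , bounds
  where
  card : ∀ σ → rgt σ ≡ R → ∣ σ ∣ ≡ ∣ lft σ ∣ + ∣ R ∣
  card σ refl = ∣σ∣≡∣lft∣+∣rgt∣ σ

  filled : Bounds S s (twisted R z)
  filled = exact (twisted R z) supp-y cyc-y
    where
    supp-y : Supported S s (twisted R z)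
    supp-y B ∉ = trans (cong (flip (twist R B)) (supp (pair B R) λ ((B∈S , _) , size) →
      ∉ (subst S (lft-pair B R) B∈S , ℕ.+-cancelʳ-≡ ∣ R ∣ ∣ B ∣ s (begin
        ∣ B ∣ + ∣ R ∣                ≡⟨ cong (λ A → ∣ A ∣ + ∣ R ∣) (lft-pair B R) ⟨
        ∣ lft (pair B R) ∣ + ∣ R ∣   ≡⟨ card (pair B R) (rgt-pair B R) ⟨
        ∣ pair B R ∣                  ≡⟨ size ⟩
        s + ∣ R ∣                    ∎)))) (flip-0 (twist R B))

    cyc-y : Cycle S (twisted R z)
    cyc-y {A} A∈S = begin
      bd (twisted R z) A                    ≡⟨ flip-involutive b _ ⟨
      flip b (flip b (bd (twisted R z) A))  ≡⟨ cong (flip b) (bd-fibre R A z (λ τ R≢ → supp τ (λ ((_ , eq) , _) → R≢ eq))) ⟨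
      flip b (bd z (pair A R))              ≡⟨ cong (flip b) (cyc (subst S (sym (lft-pair A R)) A∈S , rgt-pair A R)) ⟩
      flip b 0ℚ                             ≡⟨ flip-0 b ⟩
      0ℚ                                    ∎
      where
      b = parity R xor twist R A

  w = proj₁ filled

  -- These signs cancel both the factor in `bd-fibre` and the twist in the chain that `w` fills.
  lifted u : Chain (double n)
  lifted σ = flip (twist R (lft σ)) (flip (parity R) (w (lft σ)))
  u = restrict (λ σ → rgt σ ≟ˢ R) lifted

  supp-u : Supported (Fibre S R) (suc (s + ∣ R ∣)) u
  supp-u σ ∉ with rgt σ ≟ˢ R
  ... | no  _  = refl
  ... | yes eq = trans (cong (λ q → flip (twist R (lft σ)) (flip (parity R) q))
    (proj₁ (proj₂ filled) (lft σ) (λ (σ∈S , size) → ∉ ((σ∈S , eq) , trans (card σ eq) (cong (_+ ∣ R ∣) size)))))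
    (trans (cong (flip (twist R (lft σ))) (flip-0 (parity R))) (flip-0 (twist R (lft σ))))

  u-pair : ∀ B → twisted R u B ≡ flip (parity R) (w B)
  u-pair B = begin
    flip (twist R B) (u (pair B R))
      ≡⟨ cong (flip (twist R B)) (restrict-∈ (λ σ → rgt σ ≟ˢ R) lifted (rgt-pair B R)) ⟩
    flip (twist R B) (flip (twist R (lft (pair B R))) (flip (parity R) (w (lft (pair B R)))))
      ≡⟨ cong (λ A → flip (twist R B) (flip (twist R A) (flip (parity R) (w A)))) (lft-pair B R) ⟩
    flip (twist R B) (flip (twist R B) (flip (parity R) (w B)))
      ≡⟨ flip-involutive (twist R B) _ ⟩
    flip (parity R) (w B) ∎

  bounds : ∀ {σ} → Fibre S R σ → bd u σ ≡ z σ
  bounds {σ} (A∈S , refl) = begin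
    bd u σ
      ≡⟨ cong (bd u) (pair-η σ) ⟨
    bd u (pair A R)
      ≡⟨ bd-fibre R A u (λ τ R≢ → restrict-∉ (λ σ → rgt σ ≟ˢ R) lifted R≢) ⟩
    flip (k xor t) (bd (twisted R u) A)
      ≡⟨ cong (flip (k xor t)) (trans (bd-ext u-pair A) (bd-flip k w A)) ⟩
    flip (k xor t) (flip k (bd w A))
      ≡⟨ cong (λ q → flip (k xor t) (flip k q)) (proj₂ (proj₂ filled) A∈S) ⟩
    flip (k xor t) (flip k (flip t (z (pair A R))))
      ≡⟨ cong (flip (k xor t)) (flip-xor k t (z (pair A R))) ⟨
    flip (k xor t) (flip (k xor t) (z (pair A R)))
      ≡⟨ flip-involutive (k xor t) _ ⟩
    z (pair A R)
      ≡⟨ cong z (pair-η σ) ⟩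
    z σ ∎
    where
    A = lft σ
    k = parity R
    t = twist R A

-- The second coordinate stores the complement of `T`, so adding elements to `T` is removing
-- elements of the pair and `bd` is the total differential. A pair of degree `∣ A ∣ - ∣ T ∣` has
-- size `n` plus that degree.
T : Subset (double n) → Subset n
T σ = ∁ (rgt σ)

T-anti : {σ τ : Subset (double n)} → σ ⊆ τ → T τ ⊆ T σ
T-anti {σ = σ} {τ} σ⊆τ = p⊆q⇒∁p⊇∁q {p = rgt σ} {q = rgt τ} (rgt-mono σ⊆τ)

-- Pairs of a nonface and an independent set

rank-↾≤∣X∣ : (M : Matroid n) (X : Subset n) → rank (M ↾ X) ≤ ∣ X ∣
rank-↾≤∣X∣ M X = p⊆q⇒∣p∣≤∣q∣ (proj₂ (maxIndep-indep (M ↾ X)))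

-- Extend `I` to a basis of `M ↾ X`. It contains `v`, since otherwise it would lie in `X - v`, where
-- the rank is too small.
rank-drop⇒coloop : (M : Matroid n) {X I : Subset n} {v : Fin n} →
  ¬ (rank (M ↾ X) ≤ rank (M ↾ (X - v))) → Indep M I → I ⊆ X → Indep M (I ∪ ⁅ v ⁆)
rank-drop⇒coloop M {X} {I} {v} drop I∈M I⊆X
  with J , (J∈M , J⊆X) , I⊆J , ∣J∣≡r ← extend (M ↾ X) (I∈M , I⊆X) | v ∈? J
... | yes v∈J = down-closed (independents M) (∪-lub I⊆J (⁅x⁆⊆ v∈J)) J∈M
... | no  v∉J = ⊥-elim (drop (subst (_≤ rank (M ↾ (X - v))) ∣J∣≡r
  (∣indep∣≤rank (M ↾ (X - v)) (J∈M , λ x∈J → x∈p∧x≢y⇒x∈p-y (J⊆X x∈J) λ { refl → v∉J x∈J }))))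

module _ (C : Complex n) (M : Matroid n) where

  Slab : (J K X : Subset n) → Pred (Subset (double n)) 0ℓ
  Slab J K X σ = Nonface C J ⊤ (lft σ) × Indep M (T σ) × K ⊆ T σ × T σ ⊆ X

  slab? : ∀ J K X → Decidable (Slab J K X)
  slab? J K X σ = (¬? (face? C (lft σ)) ×-dec (J ⊆? lft σ) ×-dec (lft σ ⊆? ⊤)) ×-dec
                  face? (independents M) (T σ) ×-dec (K ⊆? T σ) ×-dec (T σ ⊆? X)

  slab-convex : ∀ J K X → Convex (Slab J K X)
  slab-convex J K X ρ σ τ ρ⊆σ σ⊆τ
    ((ρ∉C , J⊆ρ , _) , Tρ∈M , _ , Tρ⊆X) (_ , _ , K⊆Tτ , _) =
    ((λ σ∈C → ρ∉C (down-closed C (lft-mono ρ⊆σ) σ∈C)) , ⊆-trans J⊆ρ (lft-mono ρ⊆σ) , ⊆⊤) ,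
    down-closed (independents M) (T-anti {σ = ρ} {σ} ρ⊆σ) Tρ∈M ,
    ⊆-trans K⊆Tτ (T-anti {σ = σ} {τ} σ⊆τ) ,
    ⊆-trans (T-anti {σ = ρ} {σ} ρ⊆σ) Tρ⊆X

  Both : Fin n → Pred (Subset (double n)) 0ℓ
  Both u σ = u ∈ lft σ × u ∈ rgt σ

  -- For js = [] and us = all of V these are the pairs A ⊆ T with A ∉ C and
  -- T ∈ M, that is, the cubes [A , T] inside the poset of independent nonfaces.

  Block : List (Fin n) → List (Fin n) → Pred (Subset (double n)) 0ℓ
  Block js us σ = Slab (fromList js) ⊥ (∁ (fromList js)) σ × All (λ u → ¬ Both u σ) us

  private
    both? : ∀ u → Decidable (Both u)
    both? u σ = (u ∈? lft σ) ×-dec (u ∈? rgt σ)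

    both-up : ∀ u {σ τ} → σ ⊆ τ → Both u σ → Both u τ
    both-up u σ⊆τ (u∈A , u∈R) = lft-mono σ⊆τ u∈A , rgt-mono σ⊆τ u∈R

    block? : ∀ js us → Decidable (Block js us)
    block? js us σ = slab? _ _ _ σ ×-dec All.all? (λ u → ¬? (both? u σ)) us

    block-convex : ∀ js us → Convex (Block js us)
    block-convex js us ρ σ τ ρ⊆σ σ⊆τ (ρ∈ , _) (τ∈ , good) =
      slab-convex _ _ _ ρ σ τ ρ⊆σ σ⊆τ ρ∈ τ∈ , All.map (λ {u} ¬both both → ¬both (both-up u σ⊆τ both)) good

  -- Where `Both u` fails, `u` becomes one more vertex at which membership in `A` implies membership
  -- in `T`. Where it holds, `u` is in `A` and out of `T`, so it joins `js`.
  module BlockSplit (js us : List (Fin n)) (u : Fin n) where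

    open Split {S = Block js us} {V = Both u}
      (block? js us) (both? u) (block-convex js us) (both-up u) public

    private
      J = fromList js

    lower≐ : lower ≐ Block js (u ∷ us)
    lower≐ = (λ ((slab , good) , ¬both) → slab , ¬both ∷ good) ,≐
             (λ { (slab , ¬both ∷ good) → (slab , good) , ¬both })

    upper≐ : upper ≐ Block (u ∷ js) us
    upper≐ =
      (λ {σ} (((((A∉C , J⊆A , _) , T∈M , _ , T⊆∁J) , good)) , u∈A , u∈R) →
        ((A∉C , ∪-lub (⁅x⁆⊆ u∈A) J⊆A , ⊆⊤) , T∈M , ⊥⊆ ,
         (λ {x} x∈T → x∉p⇒x∈∁p λ x∈uJ → [ (λ x∈u → x∈∁p⇒x∉p x∈T (subst (_∈ rgt σ) (sym (x∈⁅y⁆⇒x≡y u x∈u)) u∈R))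
                                     , x∈∁p⇒x∉p (T⊆∁J x∈T) ]′ (x∈p∪q⁻ ⁅ u ⁆ J x∈uJ))) , good) ,≐
      (λ {σ} (((A∉C , uJ⊆A , _) , T∈M , _ , T⊆∁uJ) , good) →
        (((A∉C , ⊆-trans (q⊆p∪q ⁅ u ⁆ J) uJ⊆A , ⊆⊤) , T∈M , ⊥⊆ ,
          ⊆-trans T⊆∁uJ (p⊆q⇒∁p⊇∁q (q⊆p∪q ⁅ u ⁆ J))) , good) ,
        uJ⊆A (p⊆p∪q J (x∈⁅x⁆ u)) ,
        x∉∁p⇒x∈p (λ u∈T → x∈∁p⇒x∉p (T⊆∁uJ u∈T) (p⊆p∪q J (x∈⁅x⁆ u))))

  module _ (d : ℕ) (leray : Leray d C) where

    -- Every element of `X` whose membership in `T` is still open is in `vs`. Settling one splits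
    -- the slab into `v ∈ T` and `v ∉ T`, in the manner of contraction and deletion, until `T` must
    -- equal `X`. If deleting `v` would violate the rank bound, `v` is a coloop of `M ↾ X`, can be
    -- toggled in `T`, and the slab is a cone.
    exact-slab : ∀ js vs K X {s} → (∀ {v} → v ∈ X → v ∈ K ⊎ v List.∈ vs) →
      2 + d ≤ rank (M ↾ X) → n + length js ≤ s → Exact (Slab (fromList js) K X) s
    exact-slab js [] K X {s} cover rank≥ n+js≤s with (K ⊆? X) ×-dec face? (independents M) X
    ... | no  none = exact-empty λ {σ} (_ , T∈M , K⊆T , T⊆X) _ →
      none (⊆-trans K⊆T T⊆X , subst (Indep M) (⊆-antisym T⊆X (⊆-trans X⊆K K⊆T)) T∈M)
      where
      X⊆K : X ⊆ K
      X⊆K x∈X = [ (λ x∈K → x∈K) , (λ ()) ]′ (cover x∈X)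
    -- Only `T = X` is left, a fibre over `∁ X`. The size remaining for `A` is at least
    -- `length js + ∣ X ∣`, and `∣ X ∣ ≥ 2 + d` by the rank bound.
    ... | yes (K⊆X , X∈M) = subst (Exact _) (ℕ.m∸n+n≡m ∣∁X∣≤s)
      (Exact-resp {S = Fibre (Nonface C J ⊤) (∁ X)} {S′ = Slab J K X}
        ((λ {σ} (nonface , R≡∁X) → let T≡X = trans (cong ∁ R≡∁X) (∁-involutive X) in
           nonface , subst (Indep M) (sym T≡X) X∈M , subst (K ⊆_) (sym T≡X) K⊆X , ⊆-reflexive T≡X) ,≐
         (λ {σ} (nonface , _ , K⊆T , T⊆X) → nonface ,
           trans (sym (∁-involutive (rgt σ))) (cong ∁ (⊆-antisym T⊆X (⊆-trans X⊆K K⊆T)))))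
        (exact-fibre (∁ X) (exact-nonfaces C d leray js ⊤ (ℕ.≤-trans
          (ℕ.+-monoʳ-≤ (length js) (ℕ.≤-trans rank≥ (rank-↾≤∣X∣ M X)))
          (ℕ.m+n≤o⇒m≤o∸n (length js + ∣ X ∣) total)))))
      where
      J = fromList js

      X⊆K : X ⊆ K
      X⊆K x∈X = [ (λ x∈K → x∈K) , (λ ()) ]′ (cover x∈X)

      total : length js + ∣ X ∣ + ∣ ∁ X ∣ ≤ s
      total = subst (_≤ s) (begin
        n + length js                     ≡⟨ ℕ.+-comm n (length js) ⟩
        length js + n                     ≡⟨ cong (length js +_) (∣p∣+∣∁p∣≡n X) ⟨
        length js + (∣ X ∣ + ∣ ∁ X ∣)    ≡⟨ ℕ.+-assoc (length js) ∣ X ∣ ∣ ∁ X ∣ ⟨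
        length js + ∣ X ∣ + ∣ ∁ X ∣      ∎) n+js≤s

      ∣∁X∣≤s : ∣ ∁ X ∣ ≤ s
      ∣∁X∣≤s = ℕ.≤-trans (ℕ.m≤n+m ∣ ∁ X ∣ (length js + ∣ X ∣)) total
    exact-slab js (v ∷ vs) K X cover rank≥ n+js≤s with v ∈? K | v ∈? X
    ... | yes v∈K | _ = exact-slab js vs K X cover′ rank≥ n+js≤s
      where
      cover′ : ∀ {x} → x ∈ X → x ∈ K ⊎ x List.∈ vs
      cover′ x∈X with cover x∈X
      ... | inj₁ x∈K          = inj₁ x∈K
      ... | inj₂ (here refl)  = inj₁ v∈K
      ... | inj₂ (there x∈vs) = inj₂ x∈vs
    ... | no _ | no v∉X = exact-slab js vs K X cover′ rank≥ n+js≤s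
      where
      cover′ : ∀ {x} → x ∈ X → x ∈ K ⊎ x List.∈ vs
      cover′ x∈X with cover x∈X
      ... | inj₁ x∈K          = inj₁ x∈K
      ... | inj₂ (here refl)  = ⊥-elim (v∉X x∈X)
      ... | inj₂ (there x∈vs) = inj₂ x∈vs
    ... | no v∉K | yes v∈X with (2 + d) ℕ.≤? rank (M ↾ (X - v))
    ...   | yes rank′≥ = Split.exact-middle {S = Slab J K X} {V = λ σ → v ∈ rgt σ}
      (slab? J K X) (λ σ → v ∈? rgt σ) (slab-convex J K X) (λ σ⊆τ → rgt-mono σ⊆τ)
      (Exact-resp {S = Slab J (K ∪ ⁅ v ⁆) X} {S′ = λ σ → Slab J K X σ × v ∉ rgt σ}
        ((λ {σ} (nonface , T∈M , Kv⊆T , T⊆X) →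
           (nonface , T∈M , ⊆-trans (p⊆p∪q ⁅ v ⁆) Kv⊆T , T⊆X) ,
           x∈∁p⇒x∉p (Kv⊆T (q⊆p∪q K ⁅ v ⁆ (x∈⁅x⁆ v)))) ,≐
         (λ {σ} ((nonface , T∈M , K⊆T , T⊆X) , v∉R) →
           nonface , T∈M , ∪-lub K⊆T (⁅x⁆⊆ (x∉p⇒x∈∁p v∉R)) , T⊆X))
        (exact-slab js vs (K ∪ ⁅ v ⁆) X cover-in rank≥ n+js≤s))
      (Exact-resp {S = Slab J K (X - v)} {S′ = λ σ → Slab J K X σ × v ∈ rgt σ}
        ((λ {σ} (nonface , T∈M , K⊆T , T⊆X-v) →
           (nonface , T∈M , K⊆T , ⊆-trans T⊆X-v (p─q⊆p X ⁅ v ⁆)) ,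
           x∉∁p⇒x∈p (λ v∈T → x∉p-x X v (T⊆X-v v∈T))) ,≐
         (λ {σ} ((nonface , T∈M , K⊆T , T⊆X) , v∈R) →
           nonface , T∈M , K⊆T , λ x∈T → x∈p∧x≢y⇒x∈p-y (T⊆X x∈T) λ { refl → x∈∁p⇒x∉p x∈T v∈R }))
        (exact-slab js vs K (X - v) cover-out rank′≥ n+js≤s))
      where
      J = fromList js

      cover-in : ∀ {x} → x ∈ X → x ∈ K ∪ ⁅ v ⁆ ⊎ x List.∈ vs
      cover-in x∈X with cover x∈X
      ... | inj₁ x∈K          = inj₁ (p⊆p∪q ⁅ v ⁆ x∈K)
      ... | inj₂ (here refl)  = inj₁ (q⊆p∪q K ⁅ v ⁆ (x∈⁅x⁆ v))
      ... | inj₂ (there x∈vs) = inj₂ x∈vs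

      cover-out : ∀ {x} → x ∈ X - v → x ∈ K ⊎ x List.∈ vs
      cover-out x∈X-v with cover (p─q⊆p X ⁅ v ⁆ x∈X-v)
      ... | inj₁ x∈K          = inj₁ x∈K
      ... | inj₂ (here refl)  = ⊥-elim (x∉p-x X v x∈X-v)
      ... | inj₂ (there x∈vs) = inj₂ x∈vs
    ...   | no  rank′≱ = exact-cone {S = Slab J K X} (rgtIx v) closed
      where
      J = fromList js

      closed : ∀ {σ} b → Slab J K X σ → Slab J K X (σ [ rgtIx v ]≔ b)
      closed {σ} b (nonface , T∈M , K⊆T , T⊆X) =
        subst (Nonface C J ⊤) (sym (lft-rgtIx σ v)) nonface ,
        subst (λ R → Indep M (∁ R) × K ⊆ ∁ R × ∁ R ⊆ X) (sym (rgt-rgtIx σ v))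
          ( down-closed (independents M) T′⊆Tv
              (rank-drop⇒coloop M (λ r≤r′ → rank′≱ (ℕ.≤-trans rank≥ r≤r′)) T∈M T⊆X)
          , (λ x∈K → x∉p⇒x∈∁p λ x∈R′ →
               [ (λ { refl → v∉K x∈K }) , x∈∁p⇒x∉p (K⊆T x∈K) ]′ (x∈p[v]≔b⁻ (rgt σ) x∈R′))
          , ⊆-trans T′⊆Tv (∪-lub T⊆X (⁅x⁆⊆ v∈X)))
        where
        T′⊆Tv : ∁ (rgt σ [ v ]≔ b) ⊆ T σ ∪ ⁅ v ⁆
        T′⊆Tv {x} x∈T′ with x Fin.≟ v
        ... | yes refl = q⊆p∪q (T σ) ⁅ v ⁆ (x∈⁅x⁆ v)
        ... | no  x≢v  = p⊆p∪q ⁅ v ⁆ (x∉p⇒x∈∁p (λ x∈R → x∈∁p⇒x∉p x∈T′ ([]≔-minimal (rgt σ) x v x≢v x∈R)))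

    module _ (rank≥ : ∀ A → Face C A → rank (M ↾ ∁ A) ≥ d + 2) where

      -- `w` is a spare vertex, still outside `J` after any of `us` has moved there. If `J` is a
      -- face, the rank hypothesis applies to its complement. Otherwise every superset of `J` is a
      -- nonface, and toggling `w` in `A` gives a cone.
      exact-block : ∀ us js {s} w → w ∉ fromList js → w List.∉ us → n + length js ≤ s →
        Exact (Block js us) s
      exact-block [] js w w∉J w∉us n+js≤s =
        Exact-resp {S = Slab J ⊥ (∁ J)} {S′ = Block js []} ((λ slab → slab , []) ,≐ proj₁) exact
        where
        J = fromList js

        exact : Exact (Slab J ⊥ (∁ J)) _
        exact with face? C J
        ... | yes J∈C = exact-slab js (allFin n) ⊥ (∁ J) (λ {v} _ → inj₂ (∈-allFin v))
          (subst (_≤ rank (M ↾ ∁ J)) (ℕ.+-comm d 2) (rank≥ J J∈C)) n+js≤s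
        ... | no  J∉C = exact-cone {S = Slab J ⊥ (∁ J)} (lftIx w) λ {σ} b ((_ , J⊆A , _) , T-cond) →
          let J⊆A′ = λ {x} (x∈J : x ∈ J) → []≔-minimal (lft σ) x w (λ { refl → w∉J x∈J }) (J⊆A x∈J)
          in  subst (Nonface C J ⊤) (sym (lft-lftIx σ w))
                ((λ A∈C → J∉C (down-closed C J⊆A′ A∈C)) , J⊆A′ , ⊆⊤) ,
              subst (λ R → Indep M (∁ R) × ⊥ ⊆ ∁ R × ∁ R ⊆ ∁ J) (sym (rgt-lftIx σ w)) T-cond
      exact-block (u ∷ us) js {s} w w∉J w∉us n+js≤s = Exact-resp (BlockSplit.lower≐ js us u)
        (BlockSplit.exact-lower js us u
          (exact-block us js w w∉J (w∉us ∘ there) n+js≤s)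
          (Exact-resp (≐-sym (BlockSplit.upper≐ js us u))
            (exact-block us (u ∷ js) w w∉uJ (w∉us ∘ there)
              (subst (_≤ suc s) (sym (ℕ.+-suc n (length js))) (s≤s n+js≤s)))))
        where
        w∉uJ : w ∉ fromList (u ∷ js)
        w∉uJ w∈ = [ (λ w∈u → w∉us (here (x∈⁅y⁆⇒x≡y u w∈u))) , w∉J ]′ (x∈p∪q⁻ ⁅ u ⁆ (fromList js) w∈)

      -- Blocks in which every vertex is prescribed or constrained

      private
        exact-splittable : ∀ js us u {s} → u ∉ fromList js → All (u ≢_) us → n + length js ≤ s →
          Exact (Block js us) s
        exact-splittable js us u u∉J u∉us = exact-block us js u u∉J (λ u∈us → All.lookup u∉us u∈us refl)

        disjoint-step : ∀ (js : List (Fin n)) {us u} → All (u ≢_) us → All (_∉ fromList js) us → All (_∉ fromList (u ∷ js)) us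
        disjoint-step js {u = u} u∉us us∉J = All.zipWith
          (λ (u≢x , x∉J) x∈ → [ (λ x∈u → u≢x (sym (x∈⁅y⁆⇒x≡y u x∈u))) , x∉J ]′ (x∈p∪q⁻ ⁅ u ⁆ (fromList js) x∈))
          (u∉us , us∉J)

        cover-step : ∀ (js : List (Fin n)) {us u} → (∀ v → v ∈ fromList js ⊎ v List.∈ (u ∷ us)) →
          ∀ v → v ∈ fromList (u ∷ js) ⊎ v List.∈ us
        cover-step js {us} {u} cover v with cover v
        ... | inj₁ v∈J          = inj₁ (q⊆p∪q ⁅ u ⁆ (fromList js) v∈J)
        ... | inj₂ (here refl)  = inj₁ (p⊆p∪q (fromList js) (x∈⁅x⁆ u))
        ... | inj₂ (there v∈us) = inj₂ v∈us

        full : Subset (double n)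
        full = pair ⊤ ⊤

        -- With every vertex in `J`, the bounds `J ⊆ A` and `T ⊆ ∁ J` leave only the whole set for
        -- `A` and the empty set for `T`.
        block⇒full : ∀ js → (∀ v → v ∈ fromList js ⊎ v List.∈ []) → ∀ {σ} → Block js [] σ → σ ≡ full
        block⇒full js cover {σ} (((_ , J⊆A , _) , _ , _ , T⊆∁J) , _) = trans (sym (pair-η σ)) (cong₂ pair
          (⊆-antisym ⊆⊤ (λ {x} _ → J⊆A (∈J x)))
          (⊆-antisym ⊆⊤ (λ {x} _ → x∉∁p⇒x∈p (λ x∈T → x∈∁p⇒x∉p (T⊆∁J x∈T) (∈J x)))))
          where
          ∈J : ∀ x → x ∈ fromList js
          ∈J x = [ (λ x∈J → x∈J) , (λ ()) ]′ (cover x)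

      -- Moving `u` from `us` to `js` raises the size by one and cannot lower the dimension, since
      -- `Block js us` is exact with `u` as spare vertex. At the end only the pair `full` is left
      -- and chains are scalars.
      dim≤1-block : ∀ us js → Unique us → All (_∉ fromList js) us →
        (∀ v → v ∈ fromList js ⊎ v List.∈ us) → Dim≤1 (Block js us) (n + length js)
      dim≤1-block [] js _ _ cover y z _ _ _ _ with (y full ≟ 0ℚ) ×-dec (z full ≟ 0ℚ)
      ... | yes (y≡0 , z≡0) = 1ℚ , 0ℚ , (λ ()) , Bounds-≡0 λ σ∈ →
        subst (λ τ → 1ℚ * y τ +ℚ 0ℚ * z τ ≡ 0ℚ) (sym (block⇒full js cover σ∈))
          (cong₂ (λ p q → 1ℚ * p +ℚ 0ℚ * q) y≡0 z≡0)
      ... | no  yz≢0 = z full , - y full , (λ (z≡0 , -y≡0) → yz≢0 (neg-injective -y≡0 , z≡0)) , Bounds-≡0 λ σ∈ →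
        subst (λ τ → z full * y τ +ℚ - y full * z τ ≡ 0ℚ) (sym (block⇒full js cover σ∈))
          (solve 2 (λ z y → z :* y :+ :- y :* z := con 0ℚ) refl (z full) (y full))
      dim≤1-block (u ∷ us) js (u∉us ∷ uniq) (u∉J ∷ us∉J) cover = Dim≤1-resp (BlockSplit.lower≐ js us u)
        (BlockSplit.dim≤1-lower js us u
          (exact-splittable js us u u∉J u∉us ℕ.≤-refl)
          (Dim≤1-resp (≐-sym (BlockSplit.upper≐ js us u))
            (subst (Dim≤1 _) (ℕ.+-suc n (length js))
              (dim≤1-block us (u ∷ js) uniq (disjoint-step js u∉us us∉J) (cover-step js cover)))))

      -- Exactness would travel along the same moves to the single pair `full`, whose indicator is a
      -- cycle with nothing of larger size to bound it.
      ¬exact-block : ∀ us js → Unique us → All (_∉ fromList js) us →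
        (∀ v → v ∈ fromList js ⊎ v List.∈ us) → length us + length js ≡ n →
        ¬ Exact (Block js us) (n + length js)
      ¬exact-block [] js _ _ cover len exact =
        let u , supp , bdu = exact indicator indicator-supported (λ {σ} σ∈ → bd-≡0 σ (λ τ σ⊆τ eq →
              restrict-∉ (_≟ˢ full) (λ _ → 1ℚ) {τ} (λ τ≡full → ℕ.1+n≢n (trans (sym eq)
                (cong ∣_∣ (trans τ≡full (sym (block⇒full js cover σ∈))))))))
        in  1≢0 (begin
              1ℚ              ≡⟨ restrict-∈ (_≟ˢ full) (λ _ → 1ℚ) refl ⟨
              indicator full  ≡⟨ bdu full∈ ⟨
              bd u full       ≡⟨ bd-≡0 full (λ τ _ _ → supp τ (λ (τ∈ , size) → ℕ.1+n≢n (begin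
                                   suc (n + length js)  ≡⟨ size ⟨
                                   ∣ τ ∣         ≡⟨ cong ∣_∣ (block⇒full js cover τ∈) ⟩
                                   ∣ full ∣      ≡⟨ ∣full∣ ⟩
                                   n + length js ∎))) ⟩
              0ℚ              ∎)
        where
        1≢0 : 1ℚ ≢ 0ℚ
        1≢0 ()

        indicator : Chain (double n)
        indicator = restrict (_≟ˢ full) (λ _ → 1ℚ)

        ∣full∣ : ∣ full ∣ ≡ n + length js
        ∣full∣ = begin
          ∣ full ∣                        ≡⟨ ∣σ∣≡∣lft∣+∣rgt∣ full ⟩
          ∣ lft full ∣ + ∣ rgt full ∣    ≡⟨ cong₂ (λ A R → ∣ A ∣ + ∣ R ∣) (lft-pair {n} ⊤ ⊤) (rgt-pair {n} ⊤ ⊤) ⟩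
          ∣ ⊤ {n} ∣ + ∣ ⊤ {n} ∣          ≡⟨ cong₂ _+_ (∣⊤∣≡n n) (∣⊤∣≡n n) ⟩
          n + n                          ≡⟨ cong (n +_) len ⟨
          n + length js                  ∎

        ∁⊤≡⊥ : ∁ (⊤ {n}) ≡ ⊥
        ∁⊤≡⊥ = Empty-unique λ (x , x∈) → x∈∁p⇒x∉p x∈ ∈⊤

        -- Otherwise the rank hypothesis at the whole ground set would give the empty set rank at
        -- least `d + 2`.
        ⊤∉C : ¬ Face C ⊤
        ⊤∉C ⊤∈C = ℕ.n≮0 (ℕ.≤-trans (ℕ.≤-trans (ℕ.m≤n+m 1 (suc d)) (subst (_≤ rank (M ↾ ∁ ⊤)) (ℕ.+-suc d 1) (rank≥ ⊤ ⊤∈C)))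
          (subst (rank (M ↾ ∁ ⊤) ≤_) (trans (cong ∣_∣ ∁⊤≡⊥) (∣⊥∣≡0 n)) (rank-↾≤∣X∣ M (∁ ⊤))))

        full∈ : Block js [] full
        full∈ = ( subst (Nonface C (fromList js) ⊤) (sym (lft-pair ⊤ ⊤)) (⊤∉C , ⊆⊤ , ⊆⊤)
                , subst (λ R → Indep M (∁ R) × ⊥ ⊆ ∁ R × ∁ R ⊆ ∁ (fromList js)) (sym (rgt-pair ⊤ ⊤))
                    (subst (λ X → Indep M X × ⊥ ⊆ X × X ⊆ ∁ (fromList js)) (sym ∁⊤≡⊥) (⊥-indep M , ⊥⊆ , ⊥⊆)))
                , []

        indicator-supported : Supported (Block js []) (n + length js) indicator
        indicator-supported σ ∉ = restrict-∉ (_≟ˢ full) (λ _ → 1ℚ) {σ} (λ { refl → ∉ (full∈ , ∣full∣) })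
      ¬exact-block (u ∷ us) js (u∉us ∷ uniq) (u∉J ∷ us∉J) cover len exact =
        ¬exact-block us (u ∷ js) uniq (disjoint-step js u∉us us∉J) (cover-step js cover)
          (trans (ℕ.+-suc (length us) (length js)) len)
          (subst (Exact _) (sym (ℕ.+-suc n (length js)))
            (Exact-resp (BlockSplit.upper≐ js us u)
              (BlockSplit.exact-upper js us u
                (exact-splittable js us u u∉J u∉us (ℕ.n≤1+n _))
                (Exact-resp (≐-sym (BlockSplit.lower≐ js us u)) exact))))

-- Locally constant functions as cycles

diag : (Subset n → ℚ) → Chain (double n)
diag {zero}  f []                      = f []
diag {suc n} f (inside  ∷ inside  ∷ σ) = 0ℚ
diag {suc n} f (inside  ∷ outside ∷ σ) = - diag (f ∘ (inside ∷_)) σ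
diag {suc n} f (outside ∷ inside  ∷ σ) = diag (f ∘ (outside ∷_)) σ
diag {suc n} f (outside ∷ outside ∷ σ) = 0ℚ

diag-cong : {f g : Subset n → ℚ} (σ : Subset (double n)) →
  (lft σ ≡ T σ → f (lft σ) ≡ g (lft σ)) → diag f σ ≡ diag g σ
diag-cong {zero}  []                      f≡g = f≡g refl
diag-cong {suc n} (inside  ∷ inside  ∷ σ) f≡g = refl
diag-cong {suc n} (inside  ∷ outside ∷ σ) f≡g = cong -_ (diag-cong σ (f≡g ∘ cong (inside ∷_)))
diag-cong {suc n} (outside ∷ inside  ∷ σ) f≡g = diag-cong σ (f≡g ∘ cong (outside ∷_))
diag-cong {suc n} (outside ∷ outside ∷ σ) f≡g = refl

diag-0 : (σ : Subset (double n)) → diag (λ _ → 0ℚ) σ ≡ 0ℚ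
diag-0 {zero}  []                      = refl
diag-0 {suc n} (inside  ∷ inside  ∷ σ) = refl
diag-0 {suc n} (inside  ∷ outside ∷ σ) = cong -_ (diag-0 σ)
diag-0 {suc n} (outside ∷ inside  ∷ σ) = diag-0 σ
diag-0 {suc n} (outside ∷ outside ∷ σ) = refl

-- The sign depends on `A` alone, so linear relations between chains `diag f` can be read off as
-- relations between the functions `f`.
diag-pair : (f : Subset n → ℚ) (A : Subset n) → diag f (pair A (∁ A)) ≡ flip (parity A) (f A)
diag-pair f []            = refl
diag-pair f (inside  ∷ A) = trans (cong -_ (diag-pair (f ∘ (inside ∷_)) A)) (neg-flip (parity A) _)
  where
  neg-flip : ∀ b q → - flip b q ≡ flip (not b) q
  neg-flip true  q = flip-involutive true q
  neg-flip false q = refl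
diag-pair f (outside ∷ A) = diag-pair (f ∘ (outside ∷_)) A

-- The two bits missing at an element of T ∖ A can be filled in two ways, whose
-- contributions cancel because the signs in diag alternate.

bd-diag : (f : Subset n → ℚ) (σ : Subset (double n)) →
  (∀ v → T σ ≡ lft σ [ v ]≔ inside → f (lft σ) ≡ f (T σ)) → bd (diag f) σ ≡ 0ℚ
bd-diag {zero}  f []                      const = refl
bd-diag {suc n} f (inside  ∷ inside  ∷ σ) const = cong (λ q → - - q) (bd-0 σ)
bd-diag {suc n} f (inside  ∷ outside ∷ σ) const = trans
  (cong (λ q → - (0ℚ +ℚ q)) (bd-neg (diag (f ∘ (inside ∷_))) σ))
  (cong (λ q → - (0ℚ +ℚ - q)) (bd-diag (f ∘ (inside ∷_)) σ (λ v → const (suc v) ∘ cong (inside ∷_))))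
bd-diag {suc n} f (outside ∷ inside  ∷ σ) const =
  cong (λ q → 0ℚ +ℚ - q) (bd-diag (f ∘ (outside ∷_)) σ (λ v → const (suc v) ∘ cong (outside ∷_)))
bd-diag {suc n} f (outside ∷ outside ∷ σ) const = begin
  - diag (f ∘ (inside ∷_)) σ +ℚ (diag (f ∘ (outside ∷_)) σ +ℚ bd (λ _ → 0ℚ) σ)
    ≡⟨ cong₂ (λ p q → - p +ℚ (diag (f ∘ (outside ∷_)) σ +ℚ q)) (diag-cong σ equal) (bd-0 σ) ⟩
  - diag (f ∘ (outside ∷_)) σ +ℚ (diag (f ∘ (outside ∷_)) σ +ℚ 0ℚ)
    ≡⟨ solve 1 (λ q → :- q :+ (q :+ con 0ℚ) := con 0ℚ) refl (diag (f ∘ (outside ∷_)) σ) ⟩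
  0ℚ ∎
  where
  equal : lft σ ≡ T σ → f (inside ∷ lft σ) ≡ f (outside ∷ lft σ)
  equal A≡T = trans (cong (f ∘ (inside ∷_)) A≡T) (sym (const zero (cong (inside ∷_) (sym A≡T))))

-- Connected components by exhaustive search

module _ {A : Set} {E : Rel A 0ℓ} (E? : B.Decidable E) (x₀ : A) where

  private
    remove : ∀ {P : Pred A 0ℓ} {y} xs (p : Any P xs) → y List.∈ xs → y ≡ lookup p ⊎ y List.∈ (xs ─ p)
    remove (x ∷ xs) (here _)  (here refl) = inj₁ refl
    remove (x ∷ xs) (here _)  (there y∈)  = inj₂ y∈
    remove (x ∷ xs) (there p) (here refl) = inj₂ (here refl)
    remove (x ∷ xs) (there p) (there y∈)  with remove xs p y∈
    ... | inj₁ y≡ = inj₁ y≡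
    ... | inj₂ y∈′ = inj₂ (there y∈′)

    -- Each round moves an element with an edge from `seen` out of `rest`, whose length `k` bounds.
    -- When `rest` has no such element, `seen` is closed.
    grow : ∀ k seen rest → length rest ≤ k → All (Star E x₀) seen →
      (∀ y → y List.∈ seen ⊎ y List.∈ rest) → x₀ List.∈ seen →
      ∃ λ seen → All (Star E x₀) seen × x₀ List.∈ seen ×
                 (∀ {x y} → x List.∈ seen → E x y → y List.∈ seen)
    grow k seen rest len≤k reach cover x₀∈ with any? (λ y → any? (λ x → E? x y) seen) rest
    ... | no  none = seen , reach , x₀∈ , closed
      where
      closed : ∀ {x y} → x List.∈ seen → E x y → y List.∈ seen
      closed {x} {y} x∈ Exy with cover y
      ... | inj₁ y∈seen = y∈seen
      ... | inj₂ y∈rest = ⊥-elim (none (Any.map (λ { refl → Any.map (λ { refl → Exy }) x∈ }) y∈rest))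
    grow (suc k) seen rest len≤k reach cover x₀∈ | yes p =
      grow k (lookup p ∷ seen) (rest ─ p)
        (s≤s⁻¹ (subst (_≤ suc k) (length-removeAt′ rest (Any.index p)) len≤k))
        (reach-new ∷ reach) cover′ (there x₀∈)
      where
      reach-new : Star E x₀ (lookup p)
      reach-new with x , x∈ , Exy ← List.find (lookup-result p) = All.lookup reach x∈ ◅◅ (Exy ◅ ε)

      cover′ : ∀ y → y List.∈ (lookup p ∷ seen) ⊎ y List.∈ (rest ─ p)
      cover′ y with cover y
      ... | inj₁ y∈seen = inj₁ (there y∈seen)
      ... | inj₂ y∈rest = [ (λ { refl → inj₁ (here refl) }) , inj₂ ]′ (remove rest p y∈rest)
    grow zero seen [] len≤k reach cover x₀∈ | yes ()

  component : ∀ xs → (∀ y → y List.∈ xs) →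
    ∃ λ seen → All (Star E x₀) seen × x₀ List.∈ seen × (∀ {x y} → x List.∈ seen → E x y → y List.∈ seen)
  component xs all = grow (length xs) (x₀ ∷ []) xs ℕ.≤-refl (ε ∷ []) (inj₂ ∘ all) (here refl)

-- Connectedness of the poset of independent nonfaces

module _ (C : Complex n) (M : Matroid n) where

  IndepNonface : Pred (Subset n) 0ℓ
  IndepNonface A = Indep M A × ¬ Face C A

  indepNonface? : Decidable IndepNonface
  indepNonface? A = face? (independents M) A ×-dec ¬? (face? C A)

  Comparable : Rel (Subset n) 0ℓ
  Comparable A B = IndepNonface A × IndepNonface B × (A ⊆ B ⊎ B ⊆ A)

  comparable? : B.Decidable Comparable
  comparable? A B = indepNonface? A ×-dec indepNonface? B ×-dec ((A ⊆? B) ⊎-dec (B ⊆? A))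

  comparable-sym : ∀ {A B} → Comparable A B → Comparable B A
  comparable-sym (A∈Q , B∈Q , A⊆⊇B) = B∈Q , A∈Q , swap A⊆⊇B

  private
    Cubes : Pred (Subset (double n)) 0ℓ
    Cubes = Block C M [] (allFin n)

    lft⊆T : ∀ {σ} → Cubes σ → lft σ ⊆ T σ
    lft⊆T (_ , good) {x} x∈A = x∉p⇒x∈∁p (λ x∈R → All.lookup good (∈-allFin x) (x∈A , x∈R))

    ∣T∣+∣rgt∣ : ∀ (σ : Subset (double n)) → ∣ T σ ∣ + ∣ rgt σ ∣ ≡ n
    ∣T∣+∣rgt∣ σ = trans (ℕ.+-comm ∣ T σ ∣ ∣ rgt σ ∣) (∣p∣+∣∁p∣≡n (rgt σ))

    -- Since `A ⊆ T`, degree 0 is the top degree, so a chain of size `n` that bounds is zero on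
    -- `Cubes`.
    cubes-size : ∀ {σ} → Cubes σ → ∣ σ ∣ ≤ n
    cubes-size {σ} σ∈ = subst (_≤ n) (sym (∣σ∣≡∣lft∣+∣rgt∣ σ))
      (ℕ.≤-trans (ℕ.+-monoˡ-≤ ∣ rgt σ ∣ (p⊆q⇒∣p∣≤∣q∣ (lft⊆T σ∈))) (ℕ.≤-reflexive (∣T∣+∣rgt∣ σ)))

    cubes-diagonal : ∀ {σ} → Cubes σ → ∣ σ ∣ ≡ n + 0 → lft σ ≡ T σ
    cubes-diagonal {σ} σ∈ size = ⊆-antisym (lft⊆T σ∈) (⊆∧∣≥∣⇒⊇ (lft⊆T σ∈)
      (ℕ.≤-reflexive (ℕ.+-cancelʳ-≡ ∣ rgt σ ∣ _ _ (begin
        ∣ T σ ∣ + ∣ rgt σ ∣    ≡⟨ ∣T∣+∣rgt∣ σ ⟩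
        n                       ≡⟨ ℕ.+-identityʳ n ⟨
        n + 0                  ≡⟨ size ⟨
        ∣ σ ∣                   ≡⟨ ∣σ∣≡∣lft∣+∣rgt∣ σ ⟩
        ∣ lft σ ∣ + ∣ rgt σ ∣  ∎))))

    diagonal-cube : ∀ {σ} → lft σ ≡ T σ → IndepNonface (lft σ) → Cubes σ × ∣ σ ∣ ≡ n + 0
    diagonal-cube {σ} A≡T (A∈M , A∉C) =
      (((A∉C , ⊥⊆ , ⊆⊤) , subst (Indep M) A≡T A∈M , ⊥⊆ , λ _ → x∉p⇒x∈∁p ∉⊥) ,
        All.tabulate (λ {u} _ (u∈A , u∈R) → x∈∁p⇒x∉p (subst (u ∈_) A≡T u∈A) u∈R)) ,
      (begin
        ∣ σ ∣                   ≡⟨ ∣σ∣≡∣lft∣+∣rgt∣ σ ⟩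
        ∣ lft σ ∣ + ∣ rgt σ ∣  ≡⟨ cong (λ A → ∣ A ∣ + ∣ rgt σ ∣) A≡T ⟩
        ∣ T σ ∣ + ∣ rgt σ ∣    ≡⟨ ∣T∣+∣rgt∣ σ ⟩
        n                       ≡⟨ ℕ.+-identityʳ n ⟨
        n + 0                  ∎)

    -- Such a `P` is a union of components of the poset, so its indicator is locally constant and
    -- `diag` turns it into a cycle.
    module Indicator {P : Pred (Subset n) 0ℓ} (P? : Decidable P)
      (P⊆Q : ∀ {A} → P A → IndepNonface A)
      (P-closed : ∀ {A B} → P A → Comparable A B → P B) where

      indicator : Subset n → ℚ
      indicator = restrict P? (λ _ → 1ℚ)

      indicator-∈ : ∀ {A} → P A → indicator A ≡ 1ℚ
      indicator-∈ = restrict-∈ P? (λ _ → 1ℚ)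

      indicator-∉ : ∀ {A} → ¬ P A → indicator A ≡ 0ℚ
      indicator-∉ = restrict-∉ P? (λ _ → 1ℚ)

      supported : Supported Cubes (n + 0) (diag indicator)
      supported σ ∉ = trans (diag-cong σ (λ A≡T →
        indicator-∉ {lft σ} (λ PA → ∉ (diagonal-cube A≡T (P⊆Q PA))))) (diag-0 σ)

      cycle : Cycle Cubes (diag indicator)
      cycle {σ} (((A∉C , _) , T∈M , _) , _) = bd-diag indicator σ λ v T≡Av →
        let A⊆T = subst (lft σ ⊆_) (sym T≡Av) (⊆[]≔inside (lft σ) v)
            A~T : Comparable (lft σ) (T σ)
            A~T = (down-closed (independents M) A⊆T T∈M , A∉C) ,
                  (T∈M , λ T∈C → A∉C (down-closed C A⊆T T∈C)) , inj₁ A⊆T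
        in  agree A~T
        where
        agree : ∀ {A B} → Comparable A B → indicator A ≡ indicator B
        agree {A} {B} A~B with P? A | P? B
        ... | yes _  | yes _  = refl
        ... | no  _  | no  _  = refl
        ... | yes PA | no ¬PB = ⊥-elim (¬PB (P-closed PA A~B))
        ... | no ¬PA | yes PB = ⊥-elim (¬PA (P-closed PB (comparable-sym A~B)))

  module _ (d : ℕ) (leray : Leray d C) (rank≥ : ∀ A → Face C A → rank (M ↾ ∁ A) ≥ d + 2) where

    -- Without independent nonfaces, `Cubes` has no pair of size `n` and is trivially exact there,
    -- against `¬exact-block`.
    indepNonface-nonempty : ∃ IndepNonface
    indepNonface-nonempty with anySubset? indepNonface?
    ... | yes found = found
    ... | no  none  = ⊥-elim (¬exact-block C M d leray rank≥ (allFin n) [] (allFin⁺ n)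
      (All.tabulate (λ _ → ∉⊥)) (λ v → inj₂ (∈-allFin v))
      (trans (ℕ.+-identityʳ _) (length-tabulate (λ i → i)))
      (exact-empty {S = Cubes} λ {σ} σ∈@(((A∉C , _) , T∈M , _) , _) size →
        none (lft σ , subst (Indep M) (sym (cubes-diagonal σ∈ size)) T∈M , A∉C)))

    -- If `B` were outside the component of `A`, the indicators of the whole poset and of that
    -- component would be independent: evaluating a relation at `B` kills the first coefficient, and
    -- then evaluating at `A` kills the second.
    indepNonface-connected : ∀ {A B} → IndepNonface A → IndepNonface B → Star Comparable A B
    indepNonface-connected {A} {B} A∈Q B∈Q
      with seen , reach , A∈seen , closed ← component comparable? A (allSubsets n) ∈-allSubsets
      with DecList._∈?_ _≟ˢ_ B seen
    ... | yes B∈seen = All.lookup reach B∈seen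
    ... | no  B∉seen = ⊥-elim (ab≢0 (a≡0 , b≡0))
      where
      InComponent : Pred (Subset n) 0ℓ
      InComponent X = IndepNonface X × X List.∈ seen

      inComponent? : Decidable InComponent
      inComponent? X = indepNonface? X ×-dec DecList._∈?_ _≟ˢ_ X seen

      inComponent-closed : ∀ {X Y} → InComponent X → Comparable X Y → InComponent Y
      inComponent-closed (_ , X∈seen) X~Y@(_ , Y∈Q , _) = Y∈Q , closed X∈seen X~Y

      indepNonface-closed : ∀ {X Y} → IndepNonface X → Comparable X Y → IndepNonface Y
      indepNonface-closed _ (_ , Y∈Q , _) = Y∈Q

      module Whole = Indicator indepNonface? id indepNonface-closed
      module Component = Indicator inComponent? proj₁ inComponent-closed

      dependence = dim≤1-block C M d leray rank≥ (allFin n) [] (allFin⁺ n)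
        (All.tabulate (λ _ → ∉⊥)) (λ v → inj₂ (∈-allFin v))
        (diag Whole.indicator) (diag Component.indicator) Whole.supported Component.supported Whole.cycle Component.cycle

      a = proj₁ dependence
      b = proj₁ (proj₂ dependence)
      ab≢0 = proj₁ (proj₂ (proj₂ dependence))
      bounds = proj₂ (proj₂ (proj₂ dependence))

      vanishes : ∀ {σ} → Cubes σ → a * diag Whole.indicator σ +ℚ b * diag Component.indicator σ ≡ 0ℚ
      vanishes {σ} σ∈ with u , supp , bdu ← bounds = trans (sym (bdu σ∈)) (bd-≡0 σ (λ τ _ _ →
        supp τ (λ (τ∈ , size) → ℕ.1+n≰n (ℕ.≤-trans (ℕ.≤-reflexive (trans (cong suc (sym (ℕ.+-identityʳ n))) (sym size)))
                                               (cubes-size τ∈)))))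

      relation : ∀ {X} → IndepNonface X → a * Whole.indicator X +ℚ b * Component.indicator X ≡ 0ℚ
      relation {X} X∈Q = unflip (parity X) (Whole.indicator X) (Component.indicator X)
        (subst (λ q → a * q +ℚ b * flip (parity X) (Component.indicator X) ≡ 0ℚ) (diag-pair Whole.indicator X)
        (subst (λ q → a * diag Whole.indicator σ +ℚ b * q ≡ 0ℚ) (diag-pair Component.indicator X)
        (vanishes (proj₁ (diagonal-cube {σ} A≡T (subst IndepNonface (sym (lft-pair X (∁ X))) X∈Q))))))
        where
        σ = pair X (∁ X)

        A≡T : lft σ ≡ T σ
        A≡T = trans (lft-pair X (∁ X)) (sym (trans (cong ∁ (rgt-pair X (∁ X))) (∁-involutive X)))

        unflip : ∀ c p q → a * flip c p +ℚ b * flip c q ≡ 0ℚ → a * p +ℚ b * q ≡ 0ℚ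
        unflip false p q eq = eq
        unflip true  p q eq = neg-injective (trans (trans (neg-distrib-+ (a * p) (b * q))
          (cong₂ _+ℚ_ (neg-distribʳ-* a p) (neg-distribʳ-* b q))) eq)

      a≡0 : a ≡ 0ℚ
      a≡0 = begin
        a                      ≡⟨ +-identityʳ a ⟨
        a +ℚ 0ℚ                 ≡⟨ cong₂ _+ℚ_ (*-identityʳ a) (*-zeroʳ b) ⟨
        a * 1ℚ +ℚ b * 0ℚ        ≡⟨ cong₂ (λ p q → a * p +ℚ b * q)
                                    (Whole.indicator-∈ B∈Q)
                                    (Component.indicator-∉ {B} (λ (_ , B∈seen) → B∉seen B∈seen)) ⟨
        a * Whole.indicator B +ℚ b * Component.indicator B  ≡⟨ relation B∈Q ⟩
        0ℚ                     ∎

      b≡0 : b ≡ 0ℚ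
      b≡0 = begin
        b                      ≡⟨ +-identityˡ b ⟨
        0ℚ +ℚ b                 ≡⟨ cong (_+ℚ b) a≡0 ⟨
        a +ℚ b                  ≡⟨ cong₂ _+ℚ_ (*-identityʳ a) (*-identityʳ b) ⟨
        a * 1ℚ +ℚ b * 1ℚ        ≡⟨ cong₂ (λ p q → a * p +ℚ b * q)
                                    (Whole.indicator-∈ A∈Q)
                                    (Component.indicator-∈ (A∈Q , A∈seen)) ⟨
        a * Whole.indicator A +ℚ b * Component.indicator A  ≡⟨ relation A∈Q ⟩
        0ℚ                     ∎

-- Bases of the dual matroid

module _ (M : Matroid n) where

  MaxIndep : Pred (Subset n) 0ℓ
  MaxIndep B = Indep M B × ∣ B ∣ ≡ rank M

  -- `W` is a basis of `M` disjoint from `A`. Its complement is independent in the dual and contains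
  -- `A`, so maximality of `A` forces `W` to be `∁ A`.
  dualBasis⇒∁-maxIndep : ∀ {A} → IsBasis (dualMatroid M) A → MaxIndep (∁ A)
  dualBasis⇒∁-maxIndep {A} (A∈M* , maximal) = subst MaxIndep W≡∁A (W∈M , A∈M*)
    where
    W = maxIndep (M ↾ ∁ A)
    W∈M = proj₁ (maxIndep-indep (M ↾ ∁ A))

    W⊆∁A : W ⊆ ∁ A
    W⊆∁A = proj₂ (maxIndep-indep (M ↾ ∁ A))

    ∁W∈M* : rank (M ↾ ∁ (∁ W)) ≡ rank M
    ∁W∈M* = ℕ.≤-antisym (rank-↾-≤ M (∁ (∁ W))) (subst (_≤ rank (M ↾ ∁ (∁ W))) A∈M*
      (∣indep∣≤rank (M ↾ ∁ (∁ W)) (W∈M , ⊆-reflexive (sym (∁-involutive W)))))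

    W≡∁A : W ≡ ∁ A
    W≡∁A = ⊆-antisym W⊆∁A (λ {x} x∈∁A → x∉∁p⇒x∈p (λ x∈∁W →
      x∈∁p⇒x∉p x∈∁A (maximal ∁W∈M* (λ y∈A → x∉p⇒x∈∁p (λ y∈W → x∈∁p⇒x∉p (W⊆∁A y∈W) y∈A)) x∈∁W)))

  maxIndep⇒∁-dualBasis : ∀ {B} → MaxIndep B → IsBasis (dualMatroid M) (∁ B)
  maxIndep⇒∁-dualBasis {B} (B∈M , ∣B∣≡r) = ∁B∈M* , maximal
    where
    ∁B∈M* : rank (M ↾ ∁ (∁ B)) ≡ rank M
    ∁B∈M* = ℕ.≤-antisym (rank-↾-≤ M (∁ (∁ B))) (subst (_≤ rank (M ↾ ∁ (∁ B))) ∣B∣≡r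
      (∣indep∣≤rank (M ↾ ∁ (∁ B)) (B∈M , ⊆-reflexive (sym (∁-involutive B)))))

    maximal : ∀ {A} → rank (M ↾ ∁ A) ≡ rank M → ∁ B ⊆ A → A ⊆ ∁ B
    maximal {A} A∈M* ∁B⊆A {x} x∈A = x∉p⇒x∈∁p (λ x∈B → x∈∁p⇒x∉p (B⊆∁A x∈B) x∈A)
      where
      ∁A⊆B : ∁ A ⊆ B
      ∁A⊆B y∈∁A = x∉∁p⇒x∈p (λ y∈∁B → x∈∁p⇒x∉p y∈∁A (∁B⊆A y∈∁B))

      B⊆∁A : B ⊆ ∁ A
      B⊆∁A = ⊆∧∣≥∣⇒⊇ ∁A⊆B (subst (_≤ ∣ ∁ A ∣) (trans A∈M* (sym ∣B∣≡r)) (rank-↾≤∣X∣ M (∁ A)))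

  -- Complements of dual independent sets have at least `rank M` elements, and `∁ B` attains the
  -- resulting bound.
  rank-dual : ∀ {B} → MaxIndep B → rank (dualMatroid M) ≡ ∣ ∁ B ∣
  rank-dual {B} B-max@(_ , ∣B∣≡r) = ℕ.≤-antisym
    (ℕ.+-cancelˡ-≤ ∣ ∁ W ∣ _ _ (ℕ.≤-trans (ℕ.≤-reflexive total) (ℕ.+-monoˡ-≤ ∣ ∁ B ∣ ∣B∣≤∣∁W∣)))
    (∣indep∣≤rank (dualMatroid M) (proj₁ (maxIndep⇒∁-dualBasis B-max)))
    where
    W = maxIndep (dualMatroid M)

    ∣B∣≤∣∁W∣ : ∣ B ∣ ≤ ∣ ∁ W ∣
    ∣B∣≤∣∁W∣ = subst (_≤ ∣ ∁ W ∣) (trans (maxIndep-indep (dualMatroid M)) (sym ∣B∣≡r)) (rank-↾≤∣X∣ M (∁ W))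

    total : ∣ ∁ W ∣ + ∣ W ∣ ≡ ∣ B ∣ + ∣ ∁ B ∣
    total = trans (ℕ.+-comm ∣ ∁ W ∣ ∣ W ∣) (trans (∣p∣+∣∁p∣≡n W) (sym (∣p∣+∣∁p∣≡n B)))

-- Paths in the graph of dual bases

module _ (C : Complex n) (M : Matroid n) where

  private
    G = RG (alexanderDual C) (dualMatroid M)

  vertex : ∀ {A B} → MaxIndep M B → A ⊆ B → ¬ Face C A → IsVertex G (∁ B)
  vertex {B = B} B-max A⊆B A∉C = maxIndep⇒∁-dualBasis M B-max , λ ∁∁B∈C →
    A∉C (down-closed C (⊆-trans A⊆B (⊆-reflexive (sym (∁-involutive B)))) ∁∁B∈C)

  -- Induction on the number of elements of `B` outside `B′`. Each exchange drops such an element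
  -- `y` and takes in some `x` from `B′`. As `A ⊆ B′` avoids `y`, all bases on the way contain `A`,
  -- which keeps the unions of neighbouring complements in the dual complex.
  exchange-path : ∀ k {A B B′} → MaxIndep M B → MaxIndep M B′ → A ⊆ B → A ⊆ B′ → ¬ Face C A →
    ∣ B ∩ ∁ B′ ∣ ≤ k → Star (Adj G) (∁ B) (∁ B′)
  exchange-path k {A} {B} {B′} B-max@(B∈M , ∣B∣≡r) B′-max@(B′∈M , ∣B′∣≡r) A⊆B A⊆B′ A∉C size≤k
    with nonempty? (B ∩ ∁ B′)
  ... | no empty = subst (λ X → Star (Adj G) (∁ B) (∁ X)) B≡B′ ε
    where
    B⊆B′ : B ⊆ B′
    B⊆B′ x∈B = x∉∁p⇒x∈p (λ x∉B′ → empty (_ , x∈p∩q⁺ (x∈B , x∉B′)))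

    B≡B′ : B ≡ B′
    B≡B′ = ⊆-antisym B⊆B′ (⊆∧∣≥∣⇒⊇ B⊆B′ (ℕ.≤-reflexive (trans ∣B′∣≡r (sym ∣B∣≡r))))
  exchange-path zero {B = B} {B′} _ _ _ _ _ size≤0 | yes (y , y∈) =
    ⊥-elim (ℕ.n≮0 (ℕ.<-≤-trans (x∈p⇒∣p-x∣<∣p∣ y∈) size≤0))
  exchange-path (suc k) {A} {B} {B′} B-max@(B∈M , ∣B∣≡r) B′-max@(B′∈M , ∣B′∣≡r) A⊆B A⊆B′ A∉C size≤k
    | yes (y , y∈B∖B′)
    with y∈B , y∈∁B′ ← x∈p∩q⁻ B (∁ B′) y∈B∖B′
    with x , x∈B′ , x∉B-y , B₁∈M ← augment M (down-closed (independents M) (p─q⊆p B ⁅ y ⁆) B∈M) B′∈M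
           (subst (∣ B - y ∣ <_) (trans ∣B∣≡r (sym ∣B′∣≡r)) (x∈p⇒∣p-x∣<∣p∣ y∈B)) =
    adjacent ◅ exchange-path k B₁-max B′-max A⊆B₁ A⊆B′ A∉C (s≤s⁻¹ (ℕ.<-≤-trans smaller size≤k))
    where
    B₁ = (B - y) ∪ ⁅ x ⁆

    x≢y : x ≢ y
    x≢y refl = x∈∁p⇒x∉p y∈∁B′ x∈B′

    B₁-max : MaxIndep M B₁
    B₁-max = B₁∈M , ℕ.≤-antisym (∣indep∣≤rank M B₁∈M) r≤∣B₁∣
      where
      B⊆ : B ⊆ (B - y) ∪ ⁅ y ⁆
      B⊆ {z} z∈B with z Fin.≟ y
      ... | yes refl = q⊆p∪q (B - y) ⁅ y ⁆ (x∈⁅x⁆ y)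
      ... | no  z≢y  = p⊆p∪q ⁅ y ⁆ (x∈p∧x≢y⇒x∈p-y z∈B z≢y)

      r≤∣B₁∣ : rank M ≤ ∣ B₁ ∣
      r≤∣B₁∣ = ℕ.≤-trans (ℕ.≤-reflexive (sym ∣B∣≡r))
        (ℕ.≤-trans (p⊆q⇒∣p∣≤∣q∣ B⊆)
        (ℕ.≤-trans (∣p∪q∣≤∣p∣+∣q∣ (B - y) ⁅ y ⁆)
        (ℕ.≤-trans (ℕ.≤-reflexive (cong (∣ B - y ∣ +_) (trans (∣⁅x⁆∣≡1 y) (sym (∣⁅x⁆∣≡1 x)))))
        (disjoint⇒∣p∣+∣q∣≤∣p∪q∣ (B - y) ⁅ x ⁆
          (λ z∈ z∈x → x∉B-y (subst (_∈ B - y) (x∈⁅y⁆⇒x≡y x z∈x) z∈))))))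

    A⊆B₁ : A ⊆ B₁
    A⊆B₁ z∈A = p⊆p∪q ⁅ x ⁆ (x∈p∧x≢y⇒x∈p-y (A⊆B z∈A) λ { refl → x∈∁p⇒x∉p y∈∁B′ (A⊆B′ z∈A) })

    y∉B₁ : y ∉ B₁
    y∉B₁ y∈B₁ = [ x∉p-x B y , (λ y∈x → x≢y (sym (x∈⁅y⁆⇒x≡y x y∈x))) ]′ (x∈p∪q⁻ (B - y) ⁅ x ⁆ y∈B₁)

    smaller : ∣ B₁ ∩ ∁ B′ ∣ < ∣ B ∩ ∁ B′ ∣
    smaller = p⊂q⇒∣p∣<∣q∣ (sub , y , y∈B∖B′ , (λ y∈ → y∉B₁ (p∩q⊆p B₁ (∁ B′) y∈)))
      where
      sub : B₁ ∩ ∁ B′ ⊆ B ∩ ∁ B′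
      sub z∈ with z∈B₁ , z∈∁B′ ← x∈p∩q⁻ B₁ (∁ B′) z∈ with x∈p∪q⁻ (B - y) ⁅ x ⁆ z∈B₁
      ... | inj₁ z∈B-y = x∈p∩q⁺ (p─q⊆p B ⁅ y ⁆ z∈B-y , z∈∁B′)
      ... | inj₂ z∈x   = ⊥-elim (x∈∁p⇒x∉p z∈∁B′ (subst (_∈ B′) (sym (x∈⁅y⁆⇒x≡y x z∈x)) x∈B′))

    -- Adjacency asks for a union one larger than a dual basis: the exchange adds exactly `y` to
    -- `∁ B`.
    ∁B∪∁B₁≡ : ∁ B ∪ ∁ B₁ ≡ ∁ B ∪ ⁅ y ⁆
    ∁B∪∁B₁≡ = ⊆-antisym (∪-lub (p⊆p∪q ⁅ y ⁆) ∁B₁⊆)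
      (∪-lub (p⊆p∪q (∁ B₁)) (⁅x⁆⊆ (q⊆p∪q (∁ B) (∁ B₁) (x∉p⇒x∈∁p y∉B₁))))
      where
      ∁B₁⊆ : ∁ B₁ ⊆ ∁ B ∪ ⁅ y ⁆
      ∁B₁⊆ {z} z∈ with z Fin.≟ y
      ... | yes refl = q⊆p∪q (∁ B) ⁅ y ⁆ (x∈⁅x⁆ y)
      ... | no  z≢y  = p⊆p∪q ⁅ y ⁆ (x∉p⇒x∈∁p (λ z∈B →
        x∈∁p⇒x∉p z∈ (p⊆p∪q ⁅ x ⁆ (x∈p∧x≢y⇒x∈p-y z∈B z≢y))))

    ∣∁B∪y∣ : ∣ ∁ B ∪ ⁅ y ⁆ ∣ ≡ rank (dualMatroid M) + 1
    ∣∁B∪y∣ = trans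
      (ℕ.≤-antisym (∣p∪q∣≤∣p∣+∣q∣ (∁ B) ⁅ y ⁆)
        (disjoint⇒∣p∣+∣q∣≤∣p∪q∣ (∁ B) ⁅ y ⁆
          (λ z∈∁B z∈y → x∈∁p⇒x∉p (subst (_∈ ∁ B) (x∈⁅y⁆⇒x≡y y z∈y) z∈∁B) y∈B)))
      (cong₂ _+_ (sym (rank-dual M B-max)) (∣⁅x⁆∣≡1 y))

    A⊆∁∪ : A ⊆ ∁ (∁ B ∪ ∁ B₁)
    A⊆∁∪ z∈A = x∉p⇒x∈∁p (λ z∈ →
      [ (λ z∈∁B → x∈∁p⇒x∉p z∈∁B (A⊆B z∈A)) , (λ z∈∁B₁ → x∈∁p⇒x∉p z∈∁B₁ (A⊆B₁ z∈A)) ]′ (x∈p∪q⁻ (∁ B) (∁ B₁) z∈))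

    adjacent : Adj G (∁ B) (∁ B₁)
    adjacent = vertex B-max A⊆B A∉C , vertex B₁-max A⊆B₁ A∉C ,
      (λ ∈C → A∉C (down-closed C A⊆∁∪ ∈C)) , trans (cong ∣_∣ ∁B∪∁B₁≡) ∣∁B∪y∣

  -- A basis containing the current member of the path is carried along. A step up extends the new
  -- member to a basis, reached by exchanges over the smaller set. A step down keeps the basis.
  comparable-path⇒RG-path : ∀ {A A′ B B′} → Star (Comparable C M) A A′ → ¬ Face C A →
    MaxIndep M B → MaxIndep M B′ → A ⊆ B → A′ ⊆ B′ → Star (Adj G) (∁ B) (∁ B′)
  comparable-path⇒RG-path ε A∉C B-max B′-max A⊆B A⊆B′ =
    exchange-path _ B-max B′-max A⊆B A⊆B′ A∉C ℕ.≤-refl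
  comparable-path⇒RG-path (((A∈M , _) , (A₁∈M , A₁∉C) , inj₁ A⊆A₁) ◅ path) A∉C B-max B′-max A⊆B A′⊆B′
    with B₁ , B₁∈M , A₁⊆B₁ , ∣B₁∣≡r ← extend M A₁∈M =
    exchange-path _ B-max (B₁∈M , ∣B₁∣≡r) A⊆B (⊆-trans A⊆A₁ A₁⊆B₁) A∉C ℕ.≤-refl ◅◅
    comparable-path⇒RG-path path A₁∉C (B₁∈M , ∣B₁∣≡r) B′-max A₁⊆B₁ A′⊆B′
  comparable-path⇒RG-path ((_ , (_ , A₁∉C) , inj₂ A₁⊆A) ◅ path) A∉C B-max B′-max A⊆B A′⊆B′ =
    comparable-path⇒RG-path path A₁∉C B-max B′-max (⊆-trans A₁⊆A A⊆B) A′⊆B′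

theorem7p7 : ∀ {n : ℕ} (C : Complex n) (M : Matroid n) (d : ℕ) →
    Leray d C →
    (∀ A → Face C A → rank (M ↾ ∁ A) ≥ d + 2) →
    Connected (RG (alexanderDual C) (dualMatroid M))
theorem7p7 C M d leray rank≥ = nonempty , connected
  where
  G = RG (alexanderDual C) (dualMatroid M)

  nonempty : ∃ (IsVertex G)
  nonempty with A , A∈M , A∉C ← indepNonface-nonempty C M d leray rank≥
           with B , B∈M , A⊆B , ∣B∣≡r ← extend M A∈M =
    ∁ B , vertex C M (B∈M , ∣B∣≡r) A⊆B A∉C

  connected : ∀ X Y → IsVertex G X → IsVertex G Y → Star (Adj G) X Y
  connected X Y (X-basis , ∁X∉C) (Y-basis , ∁Y∉C)
    with ∁X∈M , ∣∁X∣≡r ← dualBasis⇒∁-maxIndep M X-basis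
    with ∁Y∈M , ∣∁Y∣≡r ← dualBasis⇒∁-maxIndep M Y-basis =
    subst (λ Z → Star (Adj G) Z Y) (∁-involutive X)
      (subst (Star (Adj G) (∁ (∁ X))) (∁-involutive Y)
        -- The complements of `X` and `Y` are bases outside `C`, hence themselves members of the
        -- poset.
        (comparable-path⇒RG-path C M
          (indepNonface-connected C M d leray rank≥ (∁X∈M , ∁X∉C) (∁Y∈M , ∁Y∉C))
          ∁X∉C (∁X∈M , ∣∁X∣≡r) (∁Y∈M , ∣∁Y∣≡r) ⊆-refl ⊆-refl))
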